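{- Let $G$ be a finite multigraph (parallel edges allowed, no loops), let $k$ be a positive integer, and let $A$ be a proper subset of $V(G)$ such that between any two distinct vertices of $A$ there are $2k$ pairwise edge-disjoint paths in $G$. Assume that there is no edge of $G$ with both endvertices outside of $A$, and let $s$ be a vertex not in $A$ with $\deg(s) > 3$. Then the lifting graph $L(G,s,\tau_A)$ is either (a) a complete multipartite graph, or (b) the disjoint union of an isolated vertex and a complete bipartite graph whose two partition classes have equal size; in particular, this case can only occur if $\deg(s)$ is odd.
   Context: Lifting two distinct edges $sx, sy$ incident with $s$ means deleting them and adding a new edge $xy$ (possibly parallel to existing edges). $\lambda_G(x,y)$ denotes the maximum number of pairwise edge-disjoint $x$–$y$ paths in $G$. The target function $\tau_A$ is defined on pairs of vertices by $\tau_A(x,y) = 2k$ if $x,y \in A$ and $\tau_A(x,y)=0$ otherwise. A pair of edges incident with $s$ is $\tau_A$-admissible if after lifting them the resulting graph $G'$ satisfies $\lambda_{G'}(x,y) \geq \tau_A(x,y)$ for all distinct $x,y \in V(G)\setminus\{s\}$. The lifting graph $L(G,s,\tau_A)$ is the graph whose vertices are the edges incident with $s$, two of them being adjacent if and only if they form a $\tau_A$-admissible pair. -}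

module Defs where

open import Data.Bool using (if_then_else_)
open import Data.Fin using (Fin; _≟_)
open import Data.Fin.Subset using (Subset; _∈_; _∉_; _∩_; ∣_∣; Nonempty; Empty)
open import Data.Fin.Subset.Properties using (_∈?_)
open import Data.List using (List; []; _∷_; length; lookup; map; filter; allFin)
open import Data.List.Relation.Binary.Disjoint.Propositional using (Disjoint)
open import Data.List.Relation.Unary.Unique.Propositional using (Unique)
open import Data.Nat using (ℕ; _*_; _≤_)
open import Data.Product using (_×_; _,_; proj₁; proj₂; ∃; ∃-syntax)
open import Data.Sum using (_⊎_)
open import Function using (_⇔_; StrictlySurjective)
open import Level using (0ℓ)
open import Relation.Binary using (Rel)
open import Relation.Binary.Construct.Closure.ReflexiveTransitive using (Star; ε; _◅_)
open import Relation.Binary.PropositionalEquality using (_≡_; _≢_)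
open import Relation.Nullary using (¬_; Dec; does; ¬?; _×-dec_; _⊎-dec_)

-- Vertices are the elements of Fin n.  Edges are the positions in a list of
-- endvertex pairs, so parallel edges are distinct; the order inside a pair is
-- irrelevant.  Loops are representable because lifting two parallel edges
-- creates one.
Multigraph : ℕ → Set
Multigraph n = List (Fin n × Fin n)

module _ {n : ℕ} where

  Edge : Multigraph n → Set
  Edge G = Fin (length G)

  ends : (G : Multigraph n) → Edge G → Fin n × Fin n
  ends = lookup

  Loopless : Multigraph n → Set
  Loopless G = ∀ e → proj₁ (ends G e) ≢ proj₂ (ends G e)

  Joins : (G : Multigraph n) → Edge G → Rel (Fin n) 0ℓ
  Joins G e x y = ends G e ≡ (x , y) ⊎ ends G e ≡ (y , x)

  Incident : (G : Multigraph n) → Fin n → Edge G → Set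
  Incident G v e = proj₁ (ends G e) ≡ v ⊎ proj₂ (ends G e) ≡ v

  incident? : (G : Multigraph n) (v : Fin n) (e : Edge G) → Dec (Incident G v e)
  incident? G v e = (proj₁ (ends G e) ≟ v) ⊎-dec (proj₂ (ends G e) ≟ v)

  incidentEdges : (G : Multigraph n) → Fin n → List (Edge G)
  incidentEdges G v = filter (incident? G v) (allFin (length G))

  -- The degree in a loopless multigraph (a loop would be counted once).
  degree : Multigraph n → Fin n → ℕ
  degree G v = length (incidentEdges G v)

  Walk : Multigraph n → Rel (Fin n) 0ℓ
  Walk G = Star (λ x y → ∃[ e ] Joins G e x y)

  walkVertices : (G : Multigraph n) → ∀ {x y} → Walk G x y → List (Fin n)
  walkVertices G {x} ε       = x ∷ []
  walkVertices G {x} (_ ◅ w) = x ∷ walkVertices G w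

  walkEdges : (G : Multigraph n) → ∀ {x y} → Walk G x y → List (Edge G)
  walkEdges G ε             = []
  walkEdges G ((e , _) ◅ w) = e ∷ walkEdges G w

  Path : Multigraph n → Rel (Fin n) 0ℓ
  Path G x y = ∃ λ (w : Walk G x y) → Unique (walkVertices G w)

  EdgeDisjoint : (G : Multigraph n) → ∀ {x y} → Rel (Path G x y) 0ℓ
  EdgeDisjoint G (v , _) (w , _) = Disjoint (walkEdges G v) (walkEdges G w)

  EdgeDisjointPaths : Multigraph n → Fin n → Fin n → ℕ → Set
  EdgeDisjointPaths G x y c =
    ∃ λ (P : Fin c → Path G x y) → ∀ i j → i ≢ j → EdgeDisjoint G (P i) (P j)

  -- λ_G(x,y) = m, for distinct x and y.
  IsLocalEdgeConnectivity : Multigraph n → Fin n → Fin n → ℕ → Set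
  IsLocalEdgeConnectivity G x y m =
    EdgeDisjointPaths G x y m × (∀ c → EdgeDisjointPaths G x y c → c ≤ m)

  -- The endvertex of e other than s, when e is incident with s.
  otherEnd : (G : Multigraph n) → Fin n → Edge G → Fin n
  otherEnd G s e =
    if does (proj₁ (ends G e) ≟ s) then proj₂ (ends G e) else proj₁ (ends G e)

  lift : (G : Multigraph n) → Fin n → Edge G → Edge G → Multigraph n
  lift G s e f =
    (otherEnd G s e , otherEnd G s f) ∷
    map (ends G) (filter (λ g → ¬? (g ≟ e) ×-dec ¬? (g ≟ f)) (allFin (length G)))

  τ : Subset n → ℕ → Fin n → Fin n → ℕ
  τ A k x y = if does ((x ∈? A) ×-dec (y ∈? A)) then 2 * k else 0

  Admissible : (G : Multigraph n) → Fin n → (Fin n → Fin n → ℕ) → Rel (Edge G) 0ℓ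
  Admissible G s t e f =
    ∀ x y → x ≢ s → y ≢ s → x ≢ y →
    ∃[ m ] IsLocalEdgeConnectivity (lift G s e f) x y m × t x y ≤ m

  -- Adjacency in L(G,s,t); its vertex i is the i-th edge incident with s.
  LiftingGraph : (G : Multigraph n) (s : Fin n) → (Fin n → Fin n → ℕ) →
                 Rel (Fin (degree G s)) 0ℓ
  LiftingGraph G s t i j =
    i ≢ j × Admissible G s t (lookup (incidentEdges G s) i) (lookup (incidentEdges G s) j)

-- At least two nonempty partition classes: an edgeless graph does not count.
CompleteMultipartite : ∀ {d} → Rel (Fin d) 0ℓ → Set
CompleteMultipartite {d} _~_ =
  ∃[ r ] 2 ≤ r × ∃ λ (class : Fin d → Fin r) →
    StrictlySurjective _≡_ class × (∀ i j → i ~ j ⇔ class i ≢ class j)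

IsolatedVertexPlusBalancedCompleteBipartite : ∀ {d} → Rel (Fin d) 0ℓ → Set
IsolatedVertexPlusBalancedCompleteBipartite {d} _~_ =
  ∃ λ (v : Fin d) → ∃ λ (P : Subset d) → ∃ λ (Q : Subset d) →
    v ∉ P × v ∉ Q × Empty (P ∩ Q) × (∀ i → i ≢ v → i ∈ P ⊎ i ∈ Q) ×
    Nonempty P × ∣ P ∣ ≡ ∣ Q ∣ ×
    (∀ i j → i ~ j ⇔ ((i ∈ P × j ∈ Q) ⊎ (i ∈ Q × j ∈ P)))

{-# OPTIONS --safe #-}

-- Call a vertex set X avoiding s and splitting A dangerous if d(X) ≤ 2k + 1.
-- Lifting two edges at s lowers d(X) by 2 if both of their other ends lie in X
-- and leaves it unchanged otherwise, so by Menger's theorem a pair is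
-- inadmissible exactly when a dangerous set contains both other ends.
-- Comparing d(X) with d(X ∪ {s}) ≥ 2k shows that a dangerous set meets at most
-- half, rounded up, of the edges at s.  If two maximal traces of dangerous sets
-- X and Y on these edges are distinct and meet, then (all neighbours of s being
-- in A) submodularity of d, applied to X ∖ Y and Y ∖ X and to X ∩ Y and X ∪ Y,
-- together with the evenness of 2k, forces them to share a single edge and to
-- cover all edges at s; there is then no third maximal trace, which is case (b).
-- Otherwise the maximal traces are pairwise disjoint, inadmissibility is an
-- equivalence relation, and we are in case (a).
module Submission where

open import Defs
open import Data.Bool using (Bool; true; false; not; _∧_; _∨_; _xor_; if_then_else_)
import Data.Bool.Properties as Bool
open import Data.Fin using (Fin; zero; suc; punchIn)
import Data.Fin as Fin
open import Data.Fin.Properties using (any?; punchInᵢ≢i; suc-injective; toℕ-fromℕ<)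
open import Data.Fin.Subset using (Subset; _∈_; _∉_; _⊆_; _⊂_; _⊃_; _∪_; _∩_; _─_; _-_; ∣_∣; ⊤; ⁅_⁆; Nonempty; Empty; inside; outside)
open import Data.Fin.Subset.Induction using (⊃-wellFounded; Acc; acc)
open import Data.Fin.Subset.Properties using (_∈?_; _⊂?_; anySubset?; nonempty?; ⊆-refl; ⊆-trans; ⊆-antisym; p⊆p∪q; q⊆p∪q; p⊆q⇒∣p∣≤∣q∣; p─q⊆p; x∈p∪q⁻; x∈p∪q⁺; x∈p∩q⁺; x∈p∩q⁻; x∈p∧x∉q⇒x∈p─q; x∈p∧x≢y⇒x∈p-y; x∈p⇒∣p-x∣<∣p∣; x∈⁅x⁆; x∈⁅y⁆⇒x≡y; ∈⊤; ∩-comm; Empty-unique; ∣⊥∣≡0; ∣⊤∣≡n; ∣⁅x⁆∣≡1)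
open import Data.Integer using (ℤ; 0ℤ; 1ℤ; -1ℤ; +≤+) renaming (+_ to pos; _+_ to _+ᶻ_; _*_ to _*ᶻ_; _-_ to _-ᶻ_; -_ to neg; _≤_ to _≤ᶻ_)
import Data.Integer.Properties as ℤ
open import Data.Integer.Tactic.RingSolver using (solve-∀)
open import Data.List using (List; []; _∷_; length; lookup; map; filter; allFin)
import Data.List as List
open import Data.List.Membership.Propositional using () renaming (_∈_ to _∈ˡ_; _∉_ to _∉ˡ_)
open import Data.List.Membership.Propositional.Properties using (∈-filter⁻; ∈-lookup)
open import Data.List.Relation.Unary.All using (All; []; _∷_)
import Data.List.Relation.Unary.All as All
open import Data.List.Relation.Unary.All.Properties using (All¬⇒¬Any)
open import Data.List.Relation.Unary.AllPairs using ([]; _∷_)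
open import Data.List.Relation.Unary.Any using (here; there)
open import Data.List.Relation.Unary.Unique.Propositional using (Unique)
open import Data.List.Relation.Unary.Unique.Propositional.Properties using (allFin⁺; filter⁺)
open import Data.Nat using (ℕ; zero; suc; _+_; _*_; _≤_; _<_; z≤n; s≤s)
open import Data.Nat.Divisibility using (_∣_; ∣1⇒≡1; ∣m+n∣m⇒∣n; m∣m*n)
import Data.Nat.Properties as ℕ
open import Data.Nat.Tactic.RingSolver using () renaming (solve-∀ to ℕ-solve-∀)
open import Data.Product using (Σ; _×_; _,_; proj₁; proj₂; ∃; ∃-syntax)
open import Data.Sum using (_⊎_; inj₁; inj₂; [_,_]′)
import Data.Sum as ⊎
open import Data.Unit using (tt) renaming (⊤ to Unit)
open import Data.Vec using ([]; _∷_; here; there; tabulate; zipWith)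
open import Data.Vec.Functional using (updateAt)
open import Data.Vec.Functional.Properties using (updateAt-updates; updateAt-minimal)
open import Data.Vec.Properties using (≡-dec; lookup∘tabulate; lookup⇒[]=; []=⇒lookup; tabulate-cong)
open import Function using (_∘_; _⇔_; mk⇔; Equivalence; StrictlySurjective; const; id)
open import Level using (0ℓ)
open import Relation.Binary using (Rel; Decidable; IsEquivalence)
open import Relation.Binary.Construct.Closure.ReflexiveTransitive using (ε; _◅_)
open import Relation.Binary.PropositionalEquality using (_≡_; _≢_; _≗_; refl; sym; trans; cong; cong₂; subst; subst₂; module ≡-Reasoning)
open import Relation.Nullary using (¬_; Dec; yes; no; does; contradiction; ¬?; _×-dec_; _⊎-dec_)
open import Relation.Nullary.Decidable using (True; toWitness; dec-true; dec-false; decidable-stable)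
open import Relation.Unary using () renaming (Decidable to Decidable₁)

import Algebra.Properties.CommutativeMonoid.Sum as Sum
module Σℕ = Sum ℕ.+-0-commutativeMonoid
module Σℤ = Sum ℤ.+-0-commutativeMonoid

-- Counting and integer sums

infix 10 [_]
[_] : Bool → ℕ
[ b ] = if b then 1 else 0

sum-replace : ∀ {m} (h h′ : Fin m → ℤ) i → (∀ j → j ≢ i → h′ j ≡ h j) →
              Σℤ.sum h′ ≡ Σℤ.sum h +ᶻ (h′ i -ᶻ h i)
sum-replace {suc m} h h′ i eq = begin
  Σℤ.sum h′                               ≡⟨ Σℤ.sum-remove {i = i} h′ ⟩
  h′ i +ᶻ Σℤ.sum (h′ ∘ punchIn i)        ≡⟨ cong (h′ i +ᶻ_) (Σℤ.sum-cong-≗ (λ j → eq _ (punchInᵢ≢i i j))) ⟩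
  h′ i +ᶻ Σℤ.sum (h ∘ punchIn i)         ≡⟨ lemma (h′ i) (h i) _ ⟩
  (h i +ᶻ Σℤ.sum (h ∘ punchIn i)) +ᶻ (h′ i -ᶻ h i) ≡⟨ cong (_+ᶻ (h′ i -ᶻ h i)) (sym (Σℤ.sum-remove {i = i} h)) ⟩
  Σℤ.sum h +ᶻ (h′ i -ᶻ h i)             ∎
  where
  open ≡-Reasoning
  lemma : ∀ a b c → a +ᶻ c ≡ (b +ᶻ c) +ᶻ (a -ᶻ b)
  lemma = solve-∀

-sum : ∀ {m} (h : Fin m → ℕ) → Σℤ.sum (λ i → neg (pos (h i))) ≡ neg (pos (Σℕ.sum h))
-sum {zero}  h = refl
-sum {suc m} h = trans (cong (neg (pos (h zero)) +ᶻ_) (-sum (h ∘ suc)))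
  (trans (sym (ℤ.neg-distrib-+ (pos (h zero)) _)) (cong neg (sym (ℤ.pos-+ (h zero) _))))

sum-nonneg : ∀ {m} (h : Fin m → ℤ) → (∀ i → 0ℤ ≤ᶻ h i) → 0ℤ ≤ᶻ Σℤ.sum h
sum-nonneg {zero}  h 0≤h = ℤ.≤-refl
sum-nonneg {suc m} h 0≤h = ℤ.+-mono-≤ (0≤h zero) (sum-nonneg (h ∘ suc) (0≤h ∘ suc))

-- Induction on `c`: once `g zero` is unmarked, injectivity keeps the other values of `g` marked,
-- while the sum drops by one. This serves to count the edges of a cut, with `g` picking one edge
-- from each path.
injection-≤-sum : ∀ {c m} (g : Fin c → Fin m) → (∀ i j → i ≢ j → g i ≢ g j) →
                  (b : Fin m → Bool) → (∀ i → b (g i) ≡ true) → c ≤ Σℕ.sum ([_] ∘ b)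
injection-≤-sum {zero}  g inj b bg = z≤n
injection-≤-sum {suc c} {zero} g inj b bg with () ← g zero
injection-≤-sum {suc c} {suc m} g inj b bg = begin
  suc c                                                   ≤⟨ s≤s ih ⟩
  suc (Σℕ.sum ([_] ∘ b′))                                 ≡⟨ cong suc (Σℕ.sum-remove {i = g₀} ([_] ∘ b′)) ⟩
  suc ([ b′ g₀ ] + Σℕ.sum (λ j → [ b′ (punchIn g₀ j) ]))  ≡⟨ cong (λ z → suc ([ z ] + Σℕ.sum (λ j → [ b′ (punchIn g₀ j) ]))) (updateAt-updates g₀ b) ⟩
  suc (Σℕ.sum (λ j → [ b′ (punchIn g₀ j) ]))              ≡⟨ cong suc (Σℕ.sum-cong-≗ (λ j → cong [_] (updateAt-minimal _ g₀ b (punchInᵢ≢i g₀ j)))) ⟩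
  suc (Σℕ.sum (λ j → [ b (punchIn g₀ j) ]))               ≡⟨ cong (λ z → [ z ] + Σℕ.sum (λ j → [ b (punchIn g₀ j) ])) (sym (bg zero)) ⟩
  [ b g₀ ] + Σℕ.sum (λ j → [ b (punchIn g₀ j) ])          ≡⟨ sym (Σℕ.sum-remove {i = g₀} ([_] ∘ b)) ⟩
  Σℕ.sum ([_] ∘ b)                                        ∎
  where
  open ℕ.≤-Reasoning
  g₀ = g zero
  b′ = updateAt b g₀ (const false)
  ih = injection-≤-sum (g ∘ suc) (λ i j i≢j → inj (suc i) (suc j) λ { refl → i≢j refl }) b′
    λ i → trans (updateAt-minimal _ g₀ b (inj (suc i) zero λ ())) (bg (suc i))

-- Menger's theorem

module Menger {n : ℕ} (G : Multigraph n) where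

  tail head : Edge G → Fin n
  tail e = proj₁ (ends G e)
  head e = proj₂ (ends G e)

  crosses : (Fin n → Bool) → Edge G → Bool
  crosses Z e = Z (tail e) xor Z (head e)

  cut : (Fin n → Bool) → ℕ
  cut Z = Σℕ.sum (λ e → [ crosses Z e ])

  source target : Edge G → Bool → Fin n
  source e true  = tail e
  source e false = head e
  target e true  = head e
  target e false = tail e

  joins : ∀ e b → Joins G e (source e b) (target e b)
  joins e true  = inj₁ refl
  joins e false = inj₂ refl

  orient : ∀ {e u v} → Joins G e u v → Bool
  orient (inj₁ _) = true
  orient (inj₂ _) = false

  Along : (Edge G → Bool → Set) → ∀ {u v} → Walk G u v → Set
  Along P ε             = Unit
  Along P ((e , j) ◅ w) = P e (orient j) × Along P w

  along-edge : ∀ {P u v} (w : Walk G u v) → Along P w → ∀ {e} → e ∈ˡ walkEdges G w → ∃ (P e)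
  along-edge ((e , j) ◅ w) (p , _)  (here refl) = _ , p
  along-edge ((e , j) ◅ w) (_ , ps) (there e∈)  = along-edge w ps e∈

  first∈ : ∀ {u v} (w : Walk G u v) → u ∈ˡ walkVertices G w
  first∈ ε       = here refl
  first∈ (_ ◅ w) = here refl

  edge-endpoints : ∀ {u v} (w : Walk G u v) {e} → e ∈ˡ walkEdges G w →
                   tail e ∈ˡ walkVertices G w × head e ∈ˡ walkVertices G w
  edge-endpoints ((e , inj₁ refl) ◅ w) (here refl) = here refl , there (first∈ w)
  edge-endpoints ((e , inj₂ refl) ◅ w) (here refl) = there (first∈ w) , here refl
  edge-endpoints (_ ◅ w) (there e∈) with p , q ← edge-endpoints w e∈ = there p , there q

  source∈ends : ∀ {e u v} → Joins G e u v → u ≡ tail e ⊎ u ≡ head e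
  source∈ends (inj₁ refl) = inj₁ refl
  source∈ends (inj₂ refl) = inj₂ refl

  -- Both ends of any edge of `w` are vertices of `w`, whereas `u` is an end of `e` that `w` avoids.
  -- Hence a simple path never repeats an edge.
  fresh-edge : ∀ {e u v y} → Joins G e u v → (w : Walk G v y) → All (u ≢_) (walkVertices G w) → e ∉ˡ walkEdges G w
  fresh-edge j w u∉ e∈ with p , q ← edge-endpoints w e∈ with source∈ends j
  ... | inj₁ refl = All¬⇒¬Any u∉ p
  ... | inj₂ refl = All¬⇒¬Any u∉ q

  -- Somewhere along the walk `Z` has to change its value; the first step where it does is taken.
  crossing-edge : ∀ (Z : Fin n → Bool) {x y} (w : Walk G x y) → Z x ≢ Z y →
                  ∃[ e ] e ∈ˡ walkEdges G w × crosses Z e ≡ true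
  crossing-edge Z ε x≢y = contradiction refl x≢y
  crossing-edge Z (_◅_ {x} {v} (e , j) w) x≢y with Z x Bool.≟ Z v
  ... | yes eq = let e′ , e′∈ , c = crossing-edge Z w (λ q → x≢y (trans eq q)) in e′ , there e′∈ , c
  ... | no neq = e , here refl , go j
    where
    xor-true : ∀ a b → a ≢ b → a xor b ≡ true
    xor-true false false a≢b = contradiction refl a≢b
    xor-true false true  _   = refl
    xor-true true  false _   = refl
    xor-true true  true  a≢b = contradiction refl a≢b
    go : Joins G e x v → crosses Z e ≡ true
    go (inj₁ refl) = xor-true _ _ neq
    go (inj₂ refl) = xor-true _ _ (neq ∘ sym)

  -- The easy half of Menger's theorem: each path uses an edge of the cut, and edge-disjointness
  -- makes the chosen edges distinct.
  disjointPaths-≤-cut : ∀ (Z : Fin n → Bool) {x y c} → Z x ≢ Z y → EdgeDisjointPaths G x y c → c ≤ cut Z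
  disjointPaths-≤-cut Z Zx≢Zy (P , disj) = injection-≤-sum (λ i → proj₁ (edge i))
    (λ i j i≢j eq → disj i j i≢j (proj₁ (proj₂ (edge i)) , subst (_∈ˡ _) (sym eq) (proj₁ (proj₂ (edge j)))))
    (crosses Z) (λ i → proj₂ (proj₂ (edge i)))
    where
    edge = λ i → crossing-edge Z (proj₁ (P i)) Zx≢Zy

  -- Searching for a simple path along permitted steps

  module _ (P : Edge G → Bool → Set) (P? : ∀ e b → Dec (P e b)) (x y : Fin n) where

    ReachedFrom : Subset n → Fin n → Set
    ReachedFrom Z u = Σ (Walk G u y) λ w → All (_∈ Z) (walkVertices G w) × Unique (walkVertices G w) × Along P w

    Enters : Subset n → Edge G → Bool → Set
    Enters Z e b = P e b × target e b ∈ Z × source e b ∉ Z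

    enters? : ∀ Z e b → Dec (Enters Z e b)
    enters? Z e b = P? e b ×-dec (target e b ∈? Z) ×-dec ¬? (source e b ∈? Z)

    -- A failed search leaves a certificate. For residual steps it yields a cut as large as the flow
    -- value; for flow-carrying steps it contradicts a positive flow value.
    SearchResult : Set
    SearchResult = (Σ (Walk G x y) λ w → Unique (walkVertices G w) × Along P w)
                 ⊎ (∃[ Z ] y ∈ Z × x ∉ Z × ∀ e b → ¬ Enters Z e b)

    orient-joins : ∀ e b → orient (joins e b) ≡ b
    orient-joins e true  = refl
    orient-joins e false = refl

    -- Paths are grown backwards from y: a vertex joins Z as the first vertex of a
    -- path within Z, so the paths stay simple.
    grow : ∀ Z → Acc _⊃_ Z → y ∈ Z → (∀ {u} → u ∈ Z → ReachedFrom Z u) → SearchResult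
    grow Z (acc rec) y∈Z reach with any? (λ e → enters? Z e true ⊎-dec enters? Z e false)
    ... | no none with x ∈? Z
    ...   | yes x∈Z = let w , _ , u , a = reach x∈Z in inj₁ (w , u , a)
    ...   | no x∉Z  = inj₂ (Z , y∈Z , x∉Z , λ where
              e true  p → none (e , inj₁ p)
              e false p → none (e , inj₂ p))
    grow Z (acc rec) y∈Z reach | yes (e , p) = [ extend true , extend false ]′ p
      where
      extend : ∀ b → Enters Z e b → SearchResult
      extend b (p , t∈ , s∉) = grow Z′ (rec (p⊆p∪q _ , v , v∈ , s∉)) (p⊆p∪q _ y∈Z) reach′
        where
        v = source e b
        Z′ = Z ∪ ⁅ v ⁆
        v∈ : v ∈ Z′
        v∈ = q⊆p∪q Z ⁅ v ⁆ (x∈⁅x⁆ v)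
        reach′ : ∀ {u} → u ∈ Z′ → ReachedFrom Z′ u
        reach′ u∈ with x∈p∪q⁻ Z ⁅ v ⁆ u∈
        ... | inj₁ u∈Z = let w , ws∈ , uw , a = reach u∈Z in w , All.map (p⊆p∪q _) ws∈ , uw , a
        ... | inj₂ u∈v rewrite x∈⁅y⁆⇒x≡y v u∈v =
          let w , ws∈ , uw , a = reach t∈ in
          (e , joins e b) ◅ w
          , v∈ ∷ All.map (p⊆p∪q _) ws∈
          , All.map (λ { z∈ refl → s∉ z∈ }) ws∈ ∷ uw
          , subst (P e) (sym (orient-joins e b)) p , a

    search : SearchResult
    search = grow ⁅ y ⁆ (⊃-wellFounded _) (x∈⁅x⁆ y) λ u∈ → from-y (x∈⁅y⁆⇒x≡y y u∈)
      where
      from-y : ∀ {u} → u ≡ y → ReachedFrom ⁅ y ⁆ u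
      from-y refl = ε , x∈⁅x⁆ y ∷ [] , [] ∷ [] , tt

  -- Flows with unit capacities

  data Dir : Set where
    fwd off bwd : Dir

  sgn : Dir → ℤ
  sgn fwd = 1ℤ
  sgn off = 0ℤ
  sgn bwd = -1ℤ

  sg : Bool → ℤ
  sg true  = 1ℤ
  sg false = -1ℤ

  flux : Dir → (Fin n → ℤ) → Edge G → ℤ
  flux d φ e = sgn d *ᶻ (φ (tail e) -ᶻ φ (head e))

  -- Summation by parts turns this into the sum over all vertices of `φ` times the net outflow. For
  -- the indicator of a set it is therefore the net flow leaving that set.
  net : (Edge G → Dir) → (Fin n → ℤ) → ℤ
  net f φ = Σℤ.sum (λ e → flux (f e) φ e)

  -- A step along e in direction b may replace f e by a value satisfying Q that
  -- differs by σ · sg b: augmenting uses σ = 1, cancelling uses σ = -1 and Q = (_≡ off).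
  Change : ℤ → (Dir → Set) → (Edge G → Dir) → Edge G → Bool → Set
  Change σ Q f e b = ∃[ d ] sgn d ≡ sgn (f e) +ᶻ σ *ᶻ sg b × Q d

  -- A step from `u` to `v` adds `σ` times `φ u` minus `φ v`, and these differences telescope along
  -- the walk. Because the walk is simple, an edge still has its old value `f e` when its turn
  -- comes.
  push : ∀ σ Q f {u y} (w : Walk G u y) → Unique (walkVertices G w) → Along (Change σ Q f) w →
         ∃[ f′ ] (∀ φ → net f′ φ ≡ net f φ +ᶻ σ *ᶻ (φ u -ᶻ φ y))
               × (∀ e → e ∉ˡ walkEdges G w → f′ e ≡ f e)
               × (∀ e → e ∈ˡ walkEdges G w → Q (f′ e))
  push σ Q f {u} ε uw al = f , (λ φ → lemma (net f φ) σ (φ u)) , (λ _ _ → refl) , λ _ ()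
    where
    lemma : ∀ a s b → a ≡ a +ᶻ s *ᶻ (b -ᶻ b)
    lemma = solve-∀
  push σ Q f {u} {y} (_◅_ {_} {v} (e , j) w) (u∉ ∷ uw) ((d , sgn-d , Qd) , al)
    with f₁ , net₁ , old₁ , new₁ ← push σ Q f w uw al = f′ , net′ , old′ , new′
    where
    open ≡-Reasoning
    f′ = updateAt f₁ e (const d)
    f′e : f′ e ≡ d
    f′e = updateAt-updates e f₁
    f₁e : f₁ e ≡ f e
    f₁e = old₁ e (fresh-edge j w u∉)
    old′ : ∀ e′ → e′ ∉ˡ walkEdges G ((e , j) ◅ w) → f′ e′ ≡ f e′
    old′ e′ e′∉ = trans (updateAt-minimal e′ e f₁ (e′∉ ∘ here)) (old₁ e′ (e′∉ ∘ there))
    new′ : ∀ e′ → e′ ∈ˡ walkEdges G ((e , j) ◅ w) → Q (f′ e′)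
    new′ e′ e′∈ with e′ Fin.≟ e
    ... | yes refl = subst Q (sym f′e) Qd
    new′ e′ (here eq)   | no neq = contradiction eq neq
    new′ e′ (there e′∈) | no neq = subst Q (sym (updateAt-minimal e′ e f₁ neq)) (new₁ e′ e′∈)
    sg-joins : ∀ φ (j : Joins G e u v) → sg (orient j) *ᶻ (φ (tail e) -ᶻ φ (head e)) ≡ φ u -ᶻ φ v
    sg-joins φ (inj₁ refl) = ℤ.*-identityˡ _
    sg-joins φ (inj₂ refl) = flip (φ (tail e)) (φ (head e))
      where
      flip : ∀ a b → -1ℤ *ᶻ (a -ᶻ b) ≡ b -ᶻ a
      flip = solve-∀
    regroup₁ : ∀ N s a b g q D → (N +ᶻ s *ᶻ (a -ᶻ b)) +ᶻ ((g +ᶻ s *ᶻ q) *ᶻ D -ᶻ g *ᶻ D)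
                               ≡ (N +ᶻ s *ᶻ (a -ᶻ b)) +ᶻ s *ᶻ (q *ᶻ D)
    regroup₁ = solve-∀
    regroup₂ : ∀ N s a b c → (N +ᶻ s *ᶻ (a -ᶻ b)) +ᶻ s *ᶻ (c -ᶻ a) ≡ N +ᶻ s *ᶻ (c -ᶻ b)
    regroup₂ = solve-∀
    net′ : ∀ φ → net f′ φ ≡ net f φ +ᶻ σ *ᶻ (φ u -ᶻ φ y)
    net′ φ = begin
      net f′ φ
        ≡⟨ sum-replace (λ e′ → flux (f₁ e′) φ e′) (λ e′ → flux (f′ e′) φ e′) e
             (λ e′ neq → cong (λ z → flux z φ e′) (updateAt-minimal e′ e f₁ neq)) ⟩
      net f₁ φ +ᶻ (flux (f′ e) φ e -ᶻ flux (f₁ e) φ e)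
        ≡⟨ cong₂ (λ p q → p +ᶻ (q *ᶻ D -ᶻ flux (f₁ e) φ e)) (net₁ φ) (trans (cong sgn f′e) sgn-d) ⟩
      (net f φ +ᶻ σ *ᶻ (φ v -ᶻ φ y)) +ᶻ ((sgn (f e) +ᶻ σ *ᶻ sg (orient j)) *ᶻ D -ᶻ flux (f₁ e) φ e)
        ≡⟨ cong (λ z → (net f φ +ᶻ σ *ᶻ (φ v -ᶻ φ y)) +ᶻ ((sgn (f e) +ᶻ σ *ᶻ sg (orient j)) *ᶻ D -ᶻ flux z φ e)) f₁e ⟩
      (net f φ +ᶻ σ *ᶻ (φ v -ᶻ φ y)) +ᶻ ((sgn (f e) +ᶻ σ *ᶻ sg (orient j)) *ᶻ D -ᶻ sgn (f e) *ᶻ D)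
        ≡⟨ regroup₁ (net f φ) σ (φ v) (φ y) (sgn (f e)) (sg (orient j)) D ⟩
      (net f φ +ᶻ σ *ᶻ (φ v -ᶻ φ y)) +ᶻ σ *ᶻ (sg (orient j) *ᶻ D)
        ≡⟨ cong (λ z → (net f φ +ᶻ σ *ᶻ (φ v -ᶻ φ y)) +ᶻ σ *ᶻ z) (sg-joins φ j) ⟩
      (net f φ +ᶻ σ *ᶻ (φ v -ᶻ φ y)) +ᶻ σ *ᶻ (φ u -ᶻ φ v)
        ≡⟨ regroup₂ (net f φ) σ (φ v) (φ y) (φ u) ⟩
      net f φ +ᶻ σ *ᶻ (φ u -ᶻ φ y) ∎
      where D = φ (tail e) -ᶻ φ (head e)

  indicator : Subset n → Fin n → Bool
  indicator Z v = does (v ∈? Z)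

  potential : Subset n → Fin n → ℤ
  potential Z v = pos [ indicator Z v ]

  module _ (x y : Fin n) where

    -- Tested against all potentials φ, this encodes conservation at every vertex
    -- other than x and y.
    Flow : ℕ → (Edge G → Dir) → Set
    Flow m f = ∀ φ → net f φ ≡ pos m *ᶻ (φ x -ᶻ φ y)

    Support : (Edge G → Dir) → Edge G → Set
    Support f e = f e ≢ off

    -- The two refused cases are the saturated edges, where the new value would have to be 2 or -2.
    augment? : ∀ f e b → Dec (Change 1ℤ (const Unit) f e b)
    augment? f e b with f e | b
    ... | fwd | true  = no λ { (fwd , () , _) ; (off , () , _) ; (bwd , () , _) }
    ... | fwd | false = yes (off , refl , tt)
    ... | off | true  = yes (fwd , refl , tt)
    ... | off | false = yes (bwd , refl , tt)
    ... | bwd | true  = yes (off , refl , tt)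
    ... | bwd | false = no λ { (fwd , () , _) ; (off , () , _) ; (bwd , () , _) }

    cancel? : ∀ f e b → Dec (Change -1ℤ (_≡ off) f e b)
    cancel? f e b with f e | b
    ... | fwd | true  = yes (off , refl , refl)
    ... | fwd | false = no λ { (_ , () , refl) }
    ... | off | true  = no λ { (_ , () , refl) }
    ... | off | false = no λ { (_ , () , refl) }
    ... | bwd | true  = no λ { (_ , () , refl) }
    ... | bwd | false = yes (off , refl , refl)

    cancel⇒support : ∀ f e b → Change -1ℤ (_≡ off) f e b → Support f e
    cancel⇒support f e b (_ , eq , refl) fe≡off rewrite fe≡off with b
    cancel⇒support f e b (_ , () , refl) fe≡off | true
    cancel⇒support f e b (_ , () , refl) fe≡off | false

    -- No residual step enters Z, so every edge across Z is saturated towards Z.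
    blocked-augment : ∀ f Z → (∀ e b → ¬ Enters (Change 1ℤ (const Unit) f) (augment? f) x y Z e b) →
                      net f (potential Z) ≡ neg (pos (cut (indicator Z)))
    blocked-augment f Z closed = trans (Σℤ.sum-cong-≗ pointwise) (-sum λ e → [ crosses (indicator Z) e ])
      where
      pointwise : ∀ e → flux (f e) (potential Z) e ≡ neg (pos [ crosses (indicator Z) e ])
      pointwise e with tail e ∈? Z | head e ∈? Z | f e | closed e true | closed e false
      ... | yes p | yes q | d   | _ | _ = ℤ.*-zeroʳ (sgn d)
      ... | no p  | no q  | d   | _ | _ = ℤ.*-zeroʳ (sgn d)
      ... | yes p | no q  | fwd | _ | c = contradiction ((off , refl , tt) , p , q) c
      ... | yes p | no q  | off | _ | c = contradiction ((bwd , refl , tt) , p , q) c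
      ... | yes p | no q  | bwd | _ | _ = refl
      ... | no p  | yes q | fwd | _ | _ = refl
      ... | no p  | yes q | off | c | _ = contradiction ((fwd , refl , tt) , q , p) c
      ... | no p  | yes q | bwd | c | _ = contradiction ((off , refl , tt) , q , p) c

    -- An edge carrying flow into `Z` would be a step entering `Z`, so every edge across the
    -- boundary carries flow outwards or none.
    blocked-cancel : ∀ f Z → (∀ e b → ¬ Enters (Change -1ℤ (_≡ off) f) (cancel? f) x y Z e b) →
                     0ℤ ≤ᶻ net f (potential Z)
    blocked-cancel f Z closed = sum-nonneg _ pointwise
      where
      pointwise : ∀ e → 0ℤ ≤ᶻ flux (f e) (potential Z) e
      pointwise e with tail e ∈? Z | head e ∈? Z | f e | closed e true | closed e false
      ... | yes p | yes q | d   | _ | _ = ℤ.≤-reflexive (sym (ℤ.*-zeroʳ (sgn d)))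
      ... | no p  | no q  | d   | _ | _ = ℤ.≤-reflexive (sym (ℤ.*-zeroʳ (sgn d)))
      ... | yes p | no q  | fwd | _ | _ = +≤+ z≤n
      ... | yes p | no q  | off | _ | _ = +≤+ z≤n
      ... | yes p | no q  | bwd | _ | c = contradiction ((off , refl , refl) , p , q) c
      ... | no p  | yes q | fwd | c | _ = contradiction ((off , refl , refl) , q , p) c
      ... | no p  | yes q | off | _ | _ = +≤+ z≤n
      ... | no p  | yes q | bwd | _ | _ = +≤+ z≤n

    flow-into : ∀ m f Z → Flow m f → y ∈ Z → x ∉ Z → net f (potential Z) ≡ neg (pos m)
    flow-into m f Z flow y∈Z x∉Z = trans (flow (potential Z)) (trans
      (cong₂ (λ a b → pos m *ᶻ (pos [ a ] -ᶻ pos [ b ])) (dec-false (x ∈? Z) x∉Z) (dec-true (y ∈? Z) y∈Z))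
      (trans (ℤ.*-comm (pos m) -1ℤ) (ℤ.-1*i≡-i (pos m))))

    flow-suc : ∀ m f f′ → Flow m f → (∀ φ → net f′ φ ≡ net f φ +ᶻ 1ℤ *ᶻ (φ x -ᶻ φ y)) → Flow (suc m) f′
    flow-suc m f f′ flow net′ φ =
      trans (net′ φ) (trans (cong (_+ᶻ (1ℤ *ᶻ (φ x -ᶻ φ y))) (flow φ)) (regroup (pos m) (φ x -ᶻ φ y)))
      where
      regroup : ∀ a d → a *ᶻ d +ᶻ 1ℤ *ᶻ d ≡ (1ℤ +ᶻ a) *ᶻ d
      regroup = solve-∀

    flow-pred : ∀ m f f′ → Flow (suc m) f → (∀ φ → net f′ φ ≡ net f φ +ᶻ -1ℤ *ᶻ (φ x -ᶻ φ y)) → Flow m f′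
    flow-pred m f f′ flow net′ φ =
      trans (net′ φ) (trans (cong (_+ᶻ (-1ℤ *ᶻ (φ x -ᶻ φ y))) (flow φ)) (regroup (pos m) (φ x -ᶻ φ y)))
      where
      regroup : ∀ a d → (1ℤ +ᶻ a) *ᶻ d +ᶻ -1ℤ *ᶻ d ≡ a *ᶻ d
      regroup = solve-∀

    -- The support condition carries the induction in `decompose`: edges of a path already removed
    -- are set to `off`, so the later paths avoid them.
    FlowPaths : (Edge G → Dir) → ℕ → Set
    FlowPaths f m = Σ (EdgeDisjointPaths G x y m) λ P →
                    ∀ i {e} → e ∈ˡ walkEdges G (proj₁ (proj₁ P i)) → Support f e

    -- Flow paths are peeled off one at a time, each lowering the value by one. If no flow path
    -- reaches `y` from `x`, the blocked set `Z` has net outflow at least 0 by `blocked-cancel`, but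
    -- negative by `flow-into`.
    decompose : ∀ m f → Flow m f → FlowPaths f m
    decompose zero    f flow = ((λ ()) , λ ()) , λ ()
    decompose (suc m) f flow with search _ (cancel? f) x y
    ... | inj₂ (Z , y∈Z , x∉Z , closed)
        with () ← subst (0ℤ ≤ᶻ_) (flow-into (suc m) f Z flow y∈Z x∉Z) (blocked-cancel f Z closed)
    ... | inj₁ (w , uw , al)
        with f′ , net′ , old , new ← push -1ℤ (_≡ off) f w uw al
        with (P , disj) , supp ← decompose m f′ (flow-pred m f f′ flow net′)
        = (P′ , disj′) , supp′
      where
      P′ : Fin (suc m) → Path G x y
      P′ zero    = w , uw
      P′ (suc i) = P i
      off-w : ∀ i {e} → e ∈ˡ walkEdges G w → e ∉ˡ walkEdges G (proj₁ (P i))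
      off-w i e∈w e∈ = supp i e∈ (new _ e∈w)
      disj′ : ∀ i j → i ≢ j → EdgeDisjoint G (P′ i) (P′ j)
      disj′ zero    zero    i≢j _       = i≢j refl
      disj′ zero    (suc j) _   (a , b) = off-w j a b
      disj′ (suc i) zero    _   (a , b) = off-w i b a
      disj′ (suc i) (suc j) i≢j         = disj i j (i≢j ∘ cong suc)
      supp′ : ∀ i {e} → e ∈ˡ walkEdges G (proj₁ (P′ i)) → Support f e
      supp′ zero    e∈ = let b , c = along-edge w al e∈ in cancel⇒support f _ b c
      supp′ (suc i) {e} e∈ fe≡off = supp i e∈ (trans (old e λ e∈w → off-w i e∈w e∈) fe≡off)

    -- Augmenting paths in the manner of Ford and Fulkerson: when the residual search fails, the
    -- flow value equals the cut of the blocked set, and decomposing the flow gives that many paths.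
    menger : x ≢ y → ∃[ Z ] indicator Z x ≢ indicator Z y × EdgeDisjointPaths G x y (cut (indicator Z))
    -- By `bounded` no flow has value above `c`, the cut around `y` alone, so with `suc c` units of
    -- fuel running out is impossible.
    menger x≢y = loop (suc c) 0 (ℕ.+-identityʳ _) (const off) λ φ → trans (zero-net φ) (sym (ℤ.*-zeroˡ (φ x -ᶻ φ y)))
      where
      Result = ∃[ Z ] indicator Z x ≢ indicator Z y × EdgeDisjointPaths G x y (cut (indicator Z))
      separates : ∀ {Z} → y ∈ Z → x ∉ Z → indicator Z x ≢ indicator Z y
      separates {Z} y∈ x∉ eq with () ← trans (trans (sym (dec-false (x ∈? Z) x∉)) eq) (dec-true (y ∈? Z) y∈)
      c = cut (indicator ⁅ y ⁆)
      bounded : ∀ m f → Flow m f → m ≤ c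
      bounded m f flow = disjointPaths-≤-cut (indicator ⁅ y ⁆)
        (separates (x∈⁅x⁆ y) (x≢y ∘ x∈⁅y⁆⇒x≡y y)) (proj₁ (decompose m f flow))
      zero-net : ∀ φ → net (const off) φ ≡ 0ℤ
      zero-net φ = Σℤ.sum-replicate-zero (length G)
      loop : ∀ fuel m → fuel + m ≡ suc c → ∀ f → Flow m f → Result
      loop zero m refl f flow = contradiction (bounded m f flow) ℕ.1+n≰n
      loop (suc fuel) m eq f flow with search _ (augment? f) x y
      ... | inj₁ (w , uw , al)
          with f′ , net′ , _ ← push 1ℤ (const Unit) f w uw al
          = loop fuel (suc m) (trans (ℕ.+-suc fuel m) eq) f′ (flow-suc m f f′ flow net′)
      ... | inj₂ (Z , y∈Z , x∉Z , closed) = Z , separates y∈Z x∉Z , subst (EdgeDisjointPaths G x y) m≡cut (proj₁ (decompose m f flow))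
        where
        m≡cut : m ≡ cut (indicator Z)
        m≡cut = ℤ.+-injective (ℤ.neg-injective (trans (sym (flow-into m f Z flow y∈Z x∉Z)) (blocked-augment f Z closed)))

-- Equivalence classes and cardinalities of subsets

open Equivalence using (to; from)

_≟ˢ_ : ∀ {d} (P Q : Subset d) → Dec (P ≡ Q)
_≟ˢ_ = ≡-dec Bool._≟_

-- Induction on `d`: element `zero` joins the class of some equivalent later element if there is
-- one, and otherwise opens a new class.
equivalence-classes : ∀ {d} {_≈_ : Rel (Fin d) 0ℓ} → IsEquivalence _≈_ → Decidable _≈_ →
  ∃[ r ] ∃ λ (class : Fin d → Fin r) → StrictlySurjective _≡_ class × (∀ i j → i ≈ j ⇔ class i ≡ class j)
equivalence-classes {zero} isEq _≈?_ = 0 , (λ ()) , (λ ()) , λ ()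
equivalence-classes {suc d} {_≈_} isEq _≈?_
  with r , class , surj , iff ← equivalence-classes {d} {λ i j → suc i ≈ suc j}
         (record { refl = IsEquivalence.refl isEq ; sym = IsEquivalence.sym isEq ; trans = IsEquivalence.trans isEq })
         (λ i j → suc i ≈? suc j)
  with any? (λ j → zero ≈? suc j)
... | yes (j , 0≈j) = r , class′ , (λ c → let i , eq = surj c in suc i , eq) , iff′
  where
  module E = IsEquivalence isEq
  class′ : Fin (suc d) → Fin r
  class′ zero    = class j
  class′ (suc i) = class i
  iff′ : ∀ a b → a ≈ b ⇔ class′ a ≡ class′ b
  iff′ zero    zero    = mk⇔ (λ _ → refl) (λ _ → E.refl)
  iff′ zero    (suc b) = mk⇔ (λ 0≈b → to (iff j b) (E.trans (E.sym 0≈j) 0≈b)) (λ eq → E.trans 0≈j (from (iff j b) eq))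
  iff′ (suc a) zero    = mk⇔ (λ a≈0 → to (iff a j) (E.trans a≈0 0≈j)) (λ eq → E.trans (from (iff a j) eq) (E.sym 0≈j))
  iff′ (suc a) (suc b) = iff a b
... | no 0≉ = suc r , class′ , surj′ , iff′
  where
  module E = IsEquivalence isEq
  class′ : Fin (suc d) → Fin (suc r)
  class′ zero    = zero
  class′ (suc i) = suc (class i)
  surj′ : StrictlySurjective _≡_ class′
  surj′ zero    = zero , refl
  surj′ (suc c) = let i , eq = surj c in suc i , cong suc eq
  iff′ : ∀ a b → a ≈ b ⇔ class′ a ≡ class′ b
  iff′ zero    zero    = mk⇔ (λ _ → refl) (λ _ → E.refl)
  iff′ zero    (suc b) = mk⇔ (λ 0≈b → contradiction (b , 0≈b) 0≉) λ ()
  iff′ (suc a) zero    = mk⇔ (λ a≈0 → contradiction (a , E.sym a≈0) 0≉) λ ()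
  iff′ (suc a) (suc b) = mk⇔ (cong suc ∘ to (iff a b)) (from (iff a b) ∘ suc-injective)

∣p∪q∣+∣p∩q∣ : ∀ {d} (p q : Subset d) → ∣ p ∪ q ∣ + ∣ p ∩ q ∣ ≡ ∣ p ∣ + ∣ q ∣
∣p∪q∣+∣p∩q∣ []            []            = refl
∣p∪q∣+∣p∩q∣ (outside ∷ p) (outside ∷ q) = ∣p∪q∣+∣p∩q∣ p q
∣p∪q∣+∣p∩q∣ (outside ∷ p) (inside  ∷ q) = trans (cong suc (∣p∪q∣+∣p∩q∣ p q)) (sym (ℕ.+-suc ∣ p ∣ ∣ q ∣))
∣p∪q∣+∣p∩q∣ (inside  ∷ p) (outside ∷ q) = cong suc (∣p∪q∣+∣p∩q∣ p q)
∣p∪q∣+∣p∩q∣ (inside  ∷ p) (inside  ∷ q) = cong suc (trans (ℕ.+-suc ∣ p ∪ q ∣ ∣ p ∩ q ∣)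
  (trans (cong suc (∣p∪q∣+∣p∩q∣ p q)) (sym (ℕ.+-suc ∣ p ∣ ∣ q ∣))))

∣p∩q∣+∣p─q∣ : ∀ {d} (p q : Subset d) → ∣ p ∩ q ∣ + ∣ p ─ q ∣ ≡ ∣ p ∣
∣p∩q∣+∣p─q∣ []            []            = refl
∣p∩q∣+∣p─q∣ (outside ∷ p) (outside ∷ q) = ∣p∩q∣+∣p─q∣ p q
∣p∩q∣+∣p─q∣ (outside ∷ p) (inside  ∷ q) = ∣p∩q∣+∣p─q∣ p q
∣p∩q∣+∣p─q∣ (inside  ∷ p) (outside ∷ q) = trans (ℕ.+-suc ∣ p ∩ q ∣ ∣ p ─ q ∣) (cong suc (∣p∩q∣+∣p─q∣ p q))
∣p∩q∣+∣p─q∣ (inside  ∷ p) (inside  ∷ q) = cong suc (∣p∩q∣+∣p─q∣ p q)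

x∈p─q⇒x∉q : ∀ {d} (p q : Subset d) {x} → x ∈ p ─ q → x ∉ q
x∈p─q⇒x∉q (_ ∷ p) (outside ∷ q) (there x∈) (there x∈q) = x∈p─q⇒x∉q p q x∈ x∈q
x∈p─q⇒x∉q (_ ∷ p) (inside  ∷ q) (there x∈) (there x∈q) = x∈p─q⇒x∉q p q x∈ x∈q

Empty⇒∣p∣≡0 : ∀ {d} (p : Subset d) → Empty p → ∣ p ∣ ≡ 0
Empty⇒∣p∣≡0 {d} p e = trans (cong ∣_∣ (Empty-unique e)) (∣⊥∣≡0 d)

-- Deleting two distinct elements would push the cardinality below 0.
∣p∣≡1⇒x≡y : ∀ {d} (p : Subset d) → ∣ p ∣ ≡ 1 → ∀ {x y} → x ∈ p → y ∈ p → x ≡ y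
∣p∣≡1⇒x≡y p eq {x} {y} x∈ y∈ = decidable-stable (x Fin.≟ y) λ x≢y →
  ℕ.n≮0 (subst (∣ (p - y) - x ∣ <_) (ℕ.n<1⇒n≡0 (subst (∣ p - y ∣ <_) eq (x∈p⇒∣p-x∣<∣p∣ y∈)))
    (x∈p⇒∣p-x∣<∣p∣ (x∈p∧x≢y⇒x∈p-y x∈ x≢y)))

-- Maximal members of a crossing family

Together : ∀ {d} → (Subset d → Set) → Rel (Fin d) 0ℓ
Together F i j = ∃[ P ] F P × i ∈ P × j ∈ P

-- The graph enters only through these hypotheses, with `F` the family of traces of dangerous sets.
-- By `cross`, two crossing members either merge into a third or are in the exceptional position
-- that leads to case (b).
module _ {d : ℕ} (3<d : 3 < d)
  (F : Subset d → Set) (F? : ∀ P → Dec (F P))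
  (half : ∀ {P} → F P → 2 * ∣ P ∣ ≤ suc d)
  (cross : ∀ {P Q} → F P → F Q → Nonempty (P ∩ Q) → Nonempty (P ─ Q) → Nonempty (Q ─ P) →
           F (P ∪ Q) ⊎ (∣ P ∩ Q ∣ ≡ 1 × P ∪ Q ≡ ⊤))
  where

  Maximal : Subset d → Set
  Maximal P = F P × ¬ (∃[ Q ] F Q × P ⊂ Q)

  maximal? : ∀ P → Dec (Maximal P)
  maximal? P = F? P ×-dec ¬? (anySubset? λ Q → F? Q ×-dec P ⊂? Q)

  extend : ∀ P → Acc _⊃_ P → F P → ∃[ M ] Maximal M × P ⊆ M
  extend P (acc rec) FP with anySubset? (λ Q → F? Q ×-dec P ⊂? Q)
  ... | no none = P , (FP , none) , ⊆-refl
  ... | yes (Q , FQ , P⊂Q) = let M , max , Q⊆M = extend Q (rec P⊂Q) FQ in M , max , ⊆-trans (proj₁ P⊂Q) Q⊆M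

  maximal⊇ : ∀ {P} → F P → ∃[ M ] Maximal M × P ⊆ M
  maximal⊇ {P} = extend P (⊃-wellFounded P)

  Crossed : Rel (Subset d) 0ℓ
  Crossed P Q = ∣ P ∩ Q ∣ ≡ 1 × P ∪ Q ≡ ⊤

  maximal-⊆ : ∀ {P Q} → Maximal P → F Q → P ⊆ Q → P ≡ Q
  maximal-⊆ {P} {Q} (FP , max) FQ P⊆Q with nonempty? (Q ─ P)
  ... | yes (x , x∈) = contradiction (Q , FQ , (λ {z} → P⊆Q {z}) , x , p─q⊆p Q P x∈ , x∈p─q⇒x∉q Q P x∈) max
  ... | no empty = ⊆-antisym P⊆Q λ {x} x∈Q → decidable-stable (x ∈? P) λ x∉P → empty (x , x∈p∧x∉q⇒x∈p─q x∈Q x∉P)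

  maximal-─ : ∀ {P Q} → Maximal P → F Q → P ≢ Q → Nonempty (P ─ Q)
  maximal-─ {P} {Q} maxP FQ P≢Q with nonempty? (P ─ Q)
  ... | yes ne = ne
  ... | no empty = contradiction (maximal-⊆ maxP FQ λ {x} x∈P → decidable-stable (x ∈? Q) λ x∉Q →
                     empty (x , x∈p∧x∉q⇒x∈p─q x∈P x∉Q)) P≢Q

  -- If the union were a member, it would properly contain `P`; only the exceptional alternative of
  -- `cross` remains.
  maximal-crossed : ∀ {P Q} → Maximal P → Maximal Q → P ≢ Q → Nonempty (P ∩ Q) → Crossed P Q
  maximal-crossed {P} {Q} maxP maxQ P≢Q meet
    with x , x∈ ← maximal-─ maxQ (proj₁ maxP) (P≢Q ∘ sym)
    with cross (proj₁ maxP) (proj₁ maxQ) meet (maximal-─ maxP (proj₁ maxQ) P≢Q) (x , x∈)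
  ... | inj₂ crossed = crossed
  ... | inj₁ F∪ = contradiction
    (P ∪ Q , F∪ , (λ {z} → p⊆p∪q Q {z}) , x , q⊆p∪q P Q (p─q⊆p Q P x∈) , x∈p─q⇒x∉q Q P x∈) (proj₂ maxP)

  module _ {_~_ : Rel (Fin d) 0ℓ} (~-iff : ∀ i j → i ~ j ⇔ (i ≢ j × ¬ Together F i j)) where

    -- The isolated vertex is the one common element of `P` and `Q`, and the classes are the two
    -- differences. The sizes of `P` and `Q` add up to `suc d` and neither exceeds half of this, so
    -- they agree.
    crossed-balanced : ∀ {P Q} → Maximal P → Maximal Q → P ≢ Q → Nonempty (P ∩ Q) →
                       IsolatedVertexPlusBalancedCompleteBipartite _~_
    crossed-balanced {P} {Q} maxP maxQ P≢Q (v , v∈∩)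
      with ∣∩∣≡1 , ∪≡⊤ ← maximal-crossed maxP maxQ P≢Q (v , v∈∩)
      = v , P ─ Q , Q ─ P
      , (λ v∈ → x∈p─q⇒x∉q P Q v∈ v∈Q) , (λ v∈ → x∈p─q⇒x∉q Q P v∈ v∈P)
      , (λ (x , x∈) → let a , b = x∈p∩q⁻ (P ─ Q) (Q ─ P) x∈ in x∈p─q⇒x∉q P Q a (p─q⊆p Q P b))
      , covered , maximal-─ maxP (proj₁ maxQ) P≢Q , ℕ.suc-injective (trans (∣─∣ P Q ∣∩∣≡1) (trans ∣P∣≡∣Q∣ (sym (∣─∣ Q P ∣∩∣≡1′))))
      , λ i j → mk⇔ (forth i j) (back i j)
      where
      v∈P = proj₁ (x∈p∩q⁻ P Q v∈∩)
      v∈Q = proj₂ (x∈p∩q⁻ P Q v∈∩)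
      ∣∩∣≡1′ : ∣ Q ∩ P ∣ ≡ 1
      ∣∩∣≡1′ = trans (cong ∣_∣ (∩-comm Q P)) ∣∩∣≡1
      ∣─∣ : ∀ (A B : Subset d) → ∣ A ∩ B ∣ ≡ 1 → suc ∣ A ─ B ∣ ≡ ∣ A ∣
      ∣─∣ A B eq = trans (cong (_+ ∣ A ─ B ∣) (sym eq)) (∣p∩q∣+∣p─q∣ A B)
      sum-eq : ∣ P ∣ + ∣ Q ∣ ≡ suc d
      sum-eq = trans (sym (∣p∪q∣+∣p∩q∣ P Q)) (trans (cong₂ _+_ (trans (cong ∣_∣ ∪≡⊤) (∣⊤∣≡n d)) ∣∩∣≡1) (ℕ.+-comm d 1))
      half-≤ : ∀ a b → 2 * a ≤ suc d → a + b ≡ suc d → a ≤ b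
      half-≤ a b h eq = ℕ.+-cancelˡ-≤ a a b (subst (_≤ a + b) (cong (a +_) (ℕ.+-identityʳ a)) (ℕ.≤-trans h (ℕ.≤-reflexive (sym eq))))
      ∣P∣≡∣Q∣ : ∣ P ∣ ≡ ∣ Q ∣
      ∣P∣≡∣Q∣ = ℕ.≤-antisym (half-≤ _ _ (half (proj₁ maxP)) sum-eq)
                            (half-≤ _ _ (half (proj₁ maxQ)) (trans (ℕ.+-comm ∣ Q ∣ ∣ P ∣) sum-eq))
      in-P-or-Q : ∀ i → i ∈ P ⊎ i ∈ Q
      in-P-or-Q i = x∈p∪q⁻ P Q (subst (i ∈_) (sym ∪≡⊤) ∈⊤)
      covered : ∀ i → i ≢ v → i ∈ P ─ Q ⊎ i ∈ Q ─ P
      covered i i≢v = ⊎.map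
        (λ i∈P → x∈p∧x∉q⇒x∈p─q i∈P λ i∈Q → i≢v (unique i∈P i∈Q))
        (λ i∈Q → x∈p∧x∉q⇒x∈p─q i∈Q λ i∈P → i≢v (unique i∈P i∈Q)) (in-P-or-Q i)
        where
        unique : ∀ {i} → i ∈ P → i ∈ Q → i ≡ v
        unique i∈P i∈Q = ∣p∣≡1⇒x≡y (P ∩ Q) ∣∩∣≡1 (x∈p∩q⁺ (i∈P , i∈Q)) v∈∩
      forth : ∀ i j → i ~ j → (i ∈ P ─ Q × j ∈ Q ─ P) ⊎ (i ∈ Q ─ P × j ∈ P ─ Q)
      forth i j i~j with i≢j , apart ← to (~-iff i j) i~j with in-P-or-Q i | in-P-or-Q j
      ... | inj₁ i∈P | inj₁ j∈P = contradiction (P , proj₁ maxP , i∈P , j∈P) apart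
      ... | inj₂ i∈Q | inj₂ j∈Q = contradiction (Q , proj₁ maxQ , i∈Q , j∈Q) apart
      ... | inj₁ i∈P | inj₂ j∈Q = inj₁ ( x∈p∧x∉q⇒x∈p─q i∈P (λ i∈Q → apart (Q , proj₁ maxQ , i∈Q , j∈Q))
                                       , x∈p∧x∉q⇒x∈p─q j∈Q (λ j∈P → apart (P , proj₁ maxP , i∈P , j∈P)))
      ... | inj₂ i∈Q | inj₁ j∈P = inj₂ ( x∈p∧x∉q⇒x∈p─q i∈Q (λ i∈P → apart (P , proj₁ maxP , i∈P , j∈P))
                                       , x∈p∧x∉q⇒x∈p─q j∈P (λ j∈Q → apart (Q , proj₁ maxQ , i∈Q , j∈Q)))
      -- Here `3<d` enters: `∣ Q ∣` is half of `suc d`, hence more than the bound 2 that a third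
      -- maximal member would force.
      5≤∣Q∣+∣Q∣ : 5 ≤ ∣ Q ∣ + ∣ Q ∣
      5≤∣Q∣+∣Q∣ = subst (5 ≤_) (trans (sym sum-eq) (cong (_+ ∣ Q ∣) ∣P∣≡∣Q∣)) (s≤s 3<d)
      -- A third maximal member would meet Q in one element and, covering the
      -- complement of P, contain Q ─ P.
      apart : ∀ {i j} → i ∈ P ─ Q → j ∈ Q ─ P → ¬ Together F i j
      apart {i} {j} i∈ j∈ (R , FR , i∈R , j∈R) with M , maxM , R⊆M ← maximal⊇ FR = ℕ.<⇒≱ 5≤∣Q∣+∣Q∣ (ℕ.+-mono-≤ ∣Q∣≤2 ∣Q∣≤2)
        where
        M≢P : P ≢ M
        M≢P refl = x∈p─q⇒x∉q Q P j∈ (R⊆M j∈R)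
        M≢Q : Q ≢ M
        M≢Q refl = x∈p─q⇒x∉q P Q i∈ (R⊆M i∈R)
        P×M = maximal-crossed maxP maxM M≢P (i , x∈p∩q⁺ (p─q⊆p P Q i∈ , R⊆M i∈R))
        Q×M = maximal-crossed maxQ maxM M≢Q (j , x∈p∩q⁺ (p─q⊆p Q P j∈ , R⊆M j∈R))
        ─⊆ : Q ─ P ⊆ Q ∩ M
        ─⊆ {x} x∈ = x∈p∩q⁺ (p─q⊆p Q P x∈ ,
          [ (λ x∈P → contradiction x∈P (x∈p─q⇒x∉q Q P x∈)) , (λ x∈M → x∈M) ]′ (x∈p∪q⁻ P M (subst (x ∈_) (sym (proj₂ P×M)) ∈⊤)))
        -- `Q ─ P` lacks just one element of `Q`, yet it fits into the one-element set `Q ∩ M`.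
        ∣Q∣≤2 : ∣ Q ∣ ≤ 2
        ∣Q∣≤2 = subst (_≤ 2) (∣─∣ Q P ∣∩∣≡1′) (s≤s (ℕ.≤-trans (p⊆q⇒∣p∣≤∣q∣ ─⊆) (ℕ.≤-reflexive (proj₁ Q×M))))
      apart-≢ : ∀ {i j} → i ∈ P ─ Q → j ∈ Q ─ P → i ≢ j
      apart-≢ i∈ j∈ refl = x∈p─q⇒x∉q P Q i∈ (p─q⊆p Q P j∈)
      back : ∀ i j → (i ∈ P ─ Q × j ∈ Q ─ P) ⊎ (i ∈ Q ─ P × j ∈ P ─ Q) → i ~ j
      back i j (inj₁ (i∈ , j∈)) = from (~-iff i j) (apart-≢ i∈ j∈ , apart i∈ j∈)
      back i j (inj₂ (i∈ , j∈)) = from (~-iff i j) (apart-≢ j∈ i∈ ∘ sym , λ (R , FR , i∈R , j∈R) → apart j∈ i∈ (R , FR , j∈R , i∈R))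

    -- Two members sharing an element lie in the same maximal member, so being equal or together is
    -- transitive, and its classes are the partition classes.
    uncrossed-multipartite : (∀ {P Q} → Maximal P → Maximal Q → Nonempty (P ∩ Q) → P ≡ Q) → CompleteMultipartite _~_
    uncrossed-multipartite uncrossed =
      let r , class , surj , iff = equivalence-classes isEq (λ i j → i Fin.≟ j ⊎-dec together? i j) in
      -- With fewer than two classes all elements would be equivalent, which `split` excludes.
      r , ℕ.≮⇒≥ (λ r<2 → split λ i j → from (iff i j) (all-equal r<2 (class i) (class j))) , class , surj
      , λ i j → mk⇔ (λ i~j eq → [ proj₁ (to (~-iff i j) i~j) , proj₂ (to (~-iff i j) i~j) ]′ (from (iff i j) eq))
                    (λ neq → from (~-iff i j) ((λ i≡j → neq (cong class i≡j)) , λ t → neq (to (iff i j) (inj₂ t))))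
      where
      _≈_ : Rel (Fin d) 0ℓ
      i ≈ j = i ≡ j ⊎ Together F i j
      together? : ∀ i j → Dec (Together F i j)
      together? i j = anySubset? λ P → F? P ×-dec i ∈? P ×-dec j ∈? P
      ≈-trans : ∀ {i j k} → i ≈ j → j ≈ k → i ≈ k
      ≈-trans (inj₁ refl) j≈k = j≈k
      ≈-trans (inj₂ t) (inj₁ refl) = inj₂ t
      ≈-trans {i} {j} {k} (inj₂ (P , FP , i∈P , j∈P)) (inj₂ (Q , FQ , j∈Q , k∈Q))
        with M , maxM , P⊆M ← maximal⊇ FP
        with N , maxN , Q⊆N ← maximal⊇ FQ
        with refl ← uncrossed maxM maxN (j , x∈p∩q⁺ (P⊆M j∈P , Q⊆N j∈Q))
        = inj₂ (M , proj₁ maxM , P⊆M i∈P , Q⊆N k∈Q)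
      isEq : IsEquivalence _≈_
      isEq = record { refl = inj₁ refl
                    ; sym = ⊎.map sym (λ (P , FP , i∈P , j∈P) → P , FP , j∈P , i∈P)
                    ; trans = ≈-trans }
      all-equal : ∀ {r} → r < 2 → (a b : Fin r) → a ≡ b
      all-equal (s≤s (s≤s z≤n)) zero zero = refl
      i₀ i₁ : Fin d
      i₀ = Fin.fromℕ< (ℕ.≤-trans (s≤s z≤n) 3<d)
      i₁ = Fin.fromℕ< (ℕ.≤-trans (s≤s (s≤s z≤n)) 3<d)
      i₀≢i₁ : i₀ ≢ i₁
      i₀≢i₁ eq with () ← trans (sym (toℕ-fromℕ< _)) (trans (cong Fin.toℕ eq) (toℕ-fromℕ< _))
      split : ¬ (∀ i j → i ≈ j)
      split all with all i₀ i₁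
      ... | inj₁ i₀≡i₁ = i₀≢i₁ i₀≡i₁
      ... | inj₂ (P , FP , i₀∈P , _) with M , maxM , P⊆M ← maximal⊇ FP
        = ℕ.<⇒≱ (ℕ.≤-trans (s≤s (s≤s z≤n)) 3<d) d≤1
        where
        all∈M : ∀ x → x ∈ M
        all∈M x with all i₀ x
        ... | inj₁ refl = P⊆M i₀∈P
        ... | inj₂ (Q , FQ , i₀∈Q , x∈Q) with N , maxN , Q⊆N ← maximal⊇ FQ
          = subst (x ∈_) (uncrossed maxN maxM (i₀ , x∈p∩q⁺ (Q⊆N i₀∈Q , P⊆M i₀∈P))) (Q⊆N x∈Q)
        ∣M∣≡d : ∣ M ∣ ≡ d
        ∣M∣≡d = trans (cong ∣_∣ (⊆-antisym {i = M} {j = ⊤} (λ _ → ∈⊤) (λ {x} _ → all∈M x))) (∣⊤∣≡n d)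
        -- A single class would make `M` the whole set, and then `half` reads `2 * d ≤ suc d`.
        d≤1 : d ≤ 1
        d≤1 = ℕ.+-cancelˡ-≤ d d 1 (subst (d + d ≤_) (ℕ.+-comm 1 d)
          (subst (_≤ suc d) (cong (d +_) (ℕ.+-identityʳ d)) (subst (λ z → 2 * z ≤ suc d) ∣M∣≡d (half (proj₁ maxM)))))

    multipartite-or-balanced : CompleteMultipartite _~_ ⊎ IsolatedVertexPlusBalancedCompleteBipartite _~_
    multipartite-or-balanced with anySubset? (λ P → anySubset? λ Q → maximal? P ×-dec maximal? Q ×-dec ¬? (P ≟ˢ Q) ×-dec nonempty? (P ∩ Q))
    ... | yes (P , Q , maxP , maxQ , P≢Q , meet) = inj₂ (crossed-balanced maxP maxQ P≢Q meet)
    ... | no none = inj₁ (uncrossed-multipartite λ {P} {Q} maxP maxQ meet →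
            decidable-stable (P ≟ˢ Q) λ P≢Q → none (P , Q , maxP , maxQ , P≢Q , meet))

-- `P`, `Q` and the isolated vertex partition the ground set, so `d` is `2 * ∣ P ∣ + 1`.
balanced⇒odd : ∀ {d} {_~_ : Rel (Fin d) 0ℓ} → IsolatedVertexPlusBalancedCompleteBipartite _~_ → ¬ (2 ∣ d)
balanced⇒odd {d} (v , P , Q , v∉P , v∉Q , disj , cover , _ , ∣P∣≡∣Q∣ , _) 2∣d =
  ℕ.1+n≢0 (ℕ.suc-injective (∣1⇒≡1 (∣m+n∣m⇒∣n (subst (2 ∣_) (sym size) 2∣d) (m∣m*n ∣ P ∣))))
  where
  R = (P ∪ Q) ∪ ⁅ v ⁆
  disjoint-∪ : ∀ (A B : Subset d) → Empty (A ∩ B) → ∣ A ∪ B ∣ ≡ ∣ A ∣ + ∣ B ∣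
  disjoint-∪ A B e = trans (sym (trans (cong (λ z → ∣ A ∪ B ∣ + z) (Empty⇒∣p∣≡0 (A ∩ B) e)) (ℕ.+-identityʳ _))) (∣p∪q∣+∣p∩q∣ A B)
  v-apart : Empty ((P ∪ Q) ∩ ⁅ v ⁆)
  v-apart (x , x∈) with a , b ← x∈p∩q⁻ (P ∪ Q) ⁅ v ⁆ x∈ with refl ← x∈⁅y⁆⇒x≡y v b = [ v∉P , v∉Q ]′ (x∈p∪q⁻ P Q a)
  all∈R : ∀ x → x ∈ R
  all∈R x with x Fin.≟ v
  ... | yes refl = q⊆p∪q (P ∪ Q) ⁅ v ⁆ (x∈⁅x⁆ v)
  ... | no x≢v = p⊆p∪q ⁅ v ⁆ (x∈p∪q⁺ (cover x x≢v))
  size : 2 * ∣ P ∣ + 1 ≡ d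
  size = begin
    2 * ∣ P ∣ + 1            ≡⟨ cong (λ z → ∣ P ∣ + z + 1) (trans (ℕ.+-identityʳ ∣ P ∣) ∣P∣≡∣Q∣) ⟩
    ∣ P ∣ + ∣ Q ∣ + 1        ≡⟨ cong₂ _+_ (sym (disjoint-∪ P Q disj)) (sym (∣⁅x⁆∣≡1 v)) ⟩
    ∣ P ∪ Q ∣ + ∣ ⁅ v ⁆ ∣    ≡⟨ sym (disjoint-∪ (P ∪ Q) ⁅ v ⁆ v-apart) ⟩
    ∣ R ∣                    ≡⟨ cong ∣_∣ (⊆-antisym {i = R} {j = ⊤} (λ _ → ∈⊤) (λ {x} _ → all∈R x)) ⟩
    ∣ ⊤ {d} ∣                ≡⟨ ∣⊤∣≡n d ⟩
    d                        ∎
    where open ≡-Reasoning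

-- Boolean identities by exhaustion

∀-Bool? : {P : Bool → Set} → (∀ b → Dec (P b)) → Dec (∀ b → P b)
∀-Bool? P? with P? true | P? false
... | yes t | yes f = yes λ { true → t ; false → f }
... | no ¬t | _     = no λ p → ¬t (p true)
... | yes _ | no ¬f = no λ p → ¬f (p false)

Bool-identity? : (l r : Bool → Bool → Bool → Bool → ℕ) → Dec (∀ a b c d → l a b c d ≡ r a b c d)
Bool-identity? l r = ∀-Bool? λ a → ∀-Bool? λ b → ∀-Bool? λ c → ∀-Bool? λ d → l a b c d ℕ.≟ r a b c d

-- The implicit argument is solved by evaluating all sixteen cases. The cut identities below need
-- this check only for a single edge, given the membership of its two ends in `X` and `Y`.
Bool-identity : (l r : Bool → Bool → Bool → Bool → ℕ) → {True (Bool-identity? l r)} → ∀ a b c d → l a b c d ≡ r a b c d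
Bool-identity l r {holds} = toWitness holds

-- Finite sums

sum-+ : ∀ {m} (f g : Fin m → ℕ) → Σℕ.sum f + Σℕ.sum g ≡ Σℕ.sum (λ i → f i + g i)
sum-+ f g = sym (Σℕ.∑-distrib-+ f g)

sum-mono : ∀ {m} {f g : Fin m → ℕ} → (∀ i → f i ≤ g i) → Σℕ.sum f ≤ Σℕ.sum g
sum-mono {zero}  f≤g = z≤n
sum-mono {suc m} f≤g = ℕ.+-mono-≤ (f≤g zero) (sum-mono (f≤g ∘ suc))

sum-single : ∀ {m} (h : Fin m → ℕ) e → Σℕ.sum (λ i → if does (i Fin.≟ e) then h i else 0) ≡ h e
sum-single {suc m} h zero    = trans (cong (h zero +_) (Σℕ.sum-replicate-zero m)) (ℕ.+-identityʳ _)
sum-single {suc m} h (suc e) = sum-single (h ∘ suc) e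

sum-lookup-tabulate : ∀ {A : Set} {m} (f : Fin m → A) (h : A → ℕ) →
                      Σℕ.sum (h ∘ lookup (List.tabulate f)) ≡ Σℕ.sum (h ∘ f)
sum-lookup-tabulate {m = zero}  f h = refl
sum-lookup-tabulate {m = suc m} f h = cong (h (f zero) +_) (sum-lookup-tabulate (f ∘ suc) h)

sum-lookup-map : ∀ {A B : Set} (g : A → B) xs (h : B → ℕ) →
                 Σℕ.sum (h ∘ lookup (map g xs)) ≡ Σℕ.sum (h ∘ g ∘ lookup xs)
sum-lookup-map g []       h = refl
sum-lookup-map g (x ∷ xs) h = cong (h (g x) +_) (sum-lookup-map g xs h)

sum-lookup-filter : ∀ {A : Set} {P : A → Set} (P? : Decidable₁ P) xs (h : A → ℕ) →
                    Σℕ.sum (h ∘ lookup (filter P? xs)) ≡ Σℕ.sum (λ i → if does (P? (lookup xs i)) then h (lookup xs i) else 0)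
sum-lookup-filter P? []       h = refl
sum-lookup-filter P? (x ∷ xs) h with does (P? x)
... | true  = cong (h x +_) (sum-lookup-filter P? xs h)
... | false = sum-lookup-filter P? xs h

-- Sums over the edges at `s`, or over the edges that survive a lift, thereby become sums over all
-- edges and can be compared term by term.
sum-filter-allFin : ∀ {m} {P : Fin m → Set} (P? : Decidable₁ P) (h : Fin m → ℕ) →
                    Σℕ.sum (h ∘ lookup (filter P? (allFin m))) ≡ Σℕ.sum (λ i → if does (P? i) then h i else 0)
sum-filter-allFin P? h = trans (sum-lookup-filter P? (allFin _) h)
  (sum-lookup-tabulate id (λ i → if does (P? i) then h i else 0))

sum-const-1 : ∀ m → Σℕ.sum {m} (λ _ → 1) ≡ m
sum-const-1 zero    = refl
sum-const-1 (suc m) = cong suc (sum-const-1 m)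

∣tabulate∣ : ∀ {m} (f : Fin m → Bool) → ∣ tabulate f ∣ ≡ Σℕ.sum ([_] ∘ f)
∣tabulate∣ {zero}  f = refl
∣tabulate∣ {suc m} f with f zero
... | true  = cong suc (∣tabulate∣ (f ∘ suc))
... | false = ∣tabulate∣ (f ∘ suc)

zipWith-tabulate : ∀ {A B C : Set} {m} (_∙_ : A → B → C) (f : Fin m → A) (g : Fin m → B) →
                   zipWith _∙_ (tabulate f) (tabulate g) ≡ tabulate (λ i → f i ∙ g i)
zipWith-tabulate {m = zero}  _∙_ f g = refl
zipWith-tabulate {m = suc m} _∙_ f g = cong (_ ∷_) (zipWith-tabulate _∙_ (f ∘ suc) (g ∘ suc))

unique-lookup : ∀ {A : Set} {xs : List A} → Unique xs → ∀ {i j} → i ≢ j → lookup xs i ≢ lookup xs j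
unique-lookup (x∉ ∷ u) {zero}  {zero}  i≢j = contradiction refl i≢j
unique-lookup (x∉ ∷ u) {zero}  {suc j} i≢j = All.lookup x∉ (∈-lookup j)
unique-lookup (x∉ ∷ u) {suc i} {zero}  i≢j = All.lookup x∉ (∈-lookup i) ∘ sym
unique-lookup (x∉ ∷ u) {suc i} {suc j} i≢j = unique-lookup u (i≢j ∘ cong suc)

-- Any excess of `p` over `K` would have to be made up by `q` falling below `L`.
squeeze-≥ : ∀ {p q K L} → K ≤ p → L ≤ q → p + q ≤ K + L → p ≡ K
squeeze-≥ {p} {q} {K} {L} K≤p L≤q le =
  ℕ.≤-antisym (ℕ.+-cancelʳ-≤ q p K (ℕ.≤-trans le (ℕ.+-monoʳ-≤ K L≤q))) K≤p

squeeze-≤ : ∀ {p q K L} → p ≤ K → q ≤ L → K + L ≤ p + q → p ≡ K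
squeeze-≤ {p} {q} {K} {L} p≤K q≤L le =
  ℕ.≤-antisym p≤K (ℕ.+-cancelʳ-≤ L K p (ℕ.≤-trans le (ℕ.+-monoʳ-≤ p q≤L)))

-- Cuts

_∪ᵇ_ _∩ᵇ_ _∖ᵇ_ : ∀ {n} → (Fin n → Bool) → (Fin n → Bool) → Fin n → Bool
(X ∪ᵇ Y) v = X v ∨ Y v
(X ∩ᵇ Y) v = X v ∧ Y v
(X ∖ᵇ Y) v = X v ∧ not (Y v)

module Cuts {n : ℕ} (G : Multigraph n) where
  open Menger G

  ∑-+ : (f g : Edge G → ℕ) → Σℕ.sum f + Σℕ.sum g ≡ Σℕ.sum (λ e → f e + g e)
  ∑-+ = sum-+

  cut-cong : ∀ {X Y} → X ≗ Y → cut X ≡ cut Y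
  cut-cong X≗Y = Σℕ.sum-cong-≗ λ e → cong [_] (cong₂ _xor_ (X≗Y (tail e)) (X≗Y (head e)))

  cut-complement : ∀ X → cut (not ∘ X) ≡ cut X
  cut-complement X = Σℕ.sum-cong-≗ λ e → cong [_] (Bool.xor-annihilates-not (X (tail e)) (X (head e)))

  between : (Fin n → Bool) → (Fin n → Bool) → Edge G → Bool
  between X Y e = (X (tail e) ∧ Y (head e)) ∨ (Y (tail e) ∧ X (head e))

  edgesBetween : (Fin n → Bool) → (Fin n → Bool) → ℕ
  edgesBetween X Y = Σℕ.sum (λ e → [ between X Y e ])

  -- Submodularity with its exact defect: an edge joining the two differences crosses `X` and `Y`
  -- but neither the intersection nor the union; all other edges count equally on both sides.
  cut-∩-∪ : ∀ X Y → cut X + cut Y ≡ (cut (X ∩ᵇ Y) + cut (X ∪ᵇ Y)) +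
                    (edgesBetween (X ∖ᵇ Y) (Y ∖ᵇ X) + edgesBetween (X ∖ᵇ Y) (Y ∖ᵇ X))
  cut-∩-∪ X Y = begin
    cut X + cut Y ≡⟨ ∑-+ _ _ ⟩
    Σℕ.sum (λ e → [ crosses X e ] + [ crosses Y e ])
      ≡⟨ Σℕ.sum-cong-≗ (λ e → pointwise (X (tail e)) (X (head e)) (Y (tail e)) (Y (head e))) ⟩
    Σℕ.sum (λ e → ([ crosses (X ∩ᵇ Y) e ] + [ crosses (X ∪ᵇ Y) e ]) + ([ between (X ∖ᵇ Y) (Y ∖ᵇ X) e ] + [ between (X ∖ᵇ Y) (Y ∖ᵇ X) e ]))
      ≡⟨ sym (∑-+ _ _) ⟩
    Σℕ.sum (λ e → [ crosses (X ∩ᵇ Y) e ] + [ crosses (X ∪ᵇ Y) e ]) + Σℕ.sum (λ e → [ between (X ∖ᵇ Y) (Y ∖ᵇ X) e ] + [ between (X ∖ᵇ Y) (Y ∖ᵇ X) e ])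
      ≡⟨ sym (cong₂ _+_ (∑-+ _ _) (∑-+ _ _)) ⟩
    _ ∎
    where
    open ≡-Reasoning
    pointwise : ∀ a b c d → [ a xor b ] + [ c xor d ] ≡
      ([ (a ∧ c) xor (b ∧ d) ] + [ (a ∨ c) xor (b ∨ d) ]) +
      ([ ((a ∧ not c) ∧ (d ∧ not b)) ∨ ((c ∧ not a) ∧ (b ∧ not d)) ] + [ ((a ∧ not c) ∧ (d ∧ not b)) ∨ ((c ∧ not a) ∧ (b ∧ not d)) ])
    pointwise = Bool-identity _ _

  -- The previous identity with `Y` complemented in spirit: now the edges from the intersection to
  -- the outside of the union cross `X` and `Y` but neither difference.
  cut-∖-∖ : ∀ X Y → cut X + cut Y ≡ (cut (X ∖ᵇ Y) + cut (Y ∖ᵇ X)) +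
                    (edgesBetween (X ∩ᵇ Y) (not ∘ (X ∪ᵇ Y)) + edgesBetween (X ∩ᵇ Y) (not ∘ (X ∪ᵇ Y)))
  cut-∖-∖ X Y = begin
    cut X + cut Y ≡⟨ ∑-+ _ _ ⟩
    Σℕ.sum (λ e → [ crosses X e ] + [ crosses Y e ])
      ≡⟨ Σℕ.sum-cong-≗ (λ e → pointwise (X (tail e)) (X (head e)) (Y (tail e)) (Y (head e))) ⟩
    Σℕ.sum (λ e → ([ crosses (X ∖ᵇ Y) e ] + [ crosses (Y ∖ᵇ X) e ]) + ([ b e ] + [ b e ]))
      ≡⟨ sym (∑-+ _ _) ⟩
    Σℕ.sum (λ e → [ crosses (X ∖ᵇ Y) e ] + [ crosses (Y ∖ᵇ X) e ]) + Σℕ.sum (λ e → [ b e ] + [ b e ])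
      ≡⟨ sym (cong₂ _+_ (∑-+ _ _) (∑-+ _ _)) ⟩
    _ ∎
    where
    open ≡-Reasoning
    b = between (X ∩ᵇ Y) (not ∘ (X ∪ᵇ Y))
    pointwise : ∀ a b c d → [ a xor b ] + [ c xor d ] ≡
      ([ (a ∧ not c) xor (b ∧ not d) ] + [ (c ∧ not a) xor (d ∧ not b) ]) +
      ([ ((a ∧ c) ∧ not (b ∨ d)) ∨ (not (a ∨ c) ∧ (b ∧ d)) ] + [ ((a ∧ c) ∧ not (b ∨ d)) ∨ (not (a ∨ c) ∧ (b ∧ d)) ])
    pointwise = Bool-identity _ _

  -- Edges between the two parts of `X` cross both parts but not `X`. They count twice, so `cut X`
  -- has the parity of the right-hand side.
  cut-∖-∩ : ∀ X Y → cut X + (edgesBetween (X ∖ᵇ Y) (X ∩ᵇ Y) + edgesBetween (X ∖ᵇ Y) (X ∩ᵇ Y)) ≡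
                    cut (X ∖ᵇ Y) + cut (X ∩ᵇ Y)
  cut-∖-∩ X Y = begin
    _ ≡⟨ cong (cut X +_) (∑-+ _ _) ⟩
    _ ≡⟨ ∑-+ _ _ ⟩
    Σℕ.sum (λ e → [ crosses X e ] + ([ b e ] + [ b e ]))
      ≡⟨ Σℕ.sum-cong-≗ (λ e → pointwise (X (tail e)) (X (head e)) (Y (tail e)) (Y (head e))) ⟩
    Σℕ.sum (λ e → [ crosses (X ∖ᵇ Y) e ] + [ crosses (X ∩ᵇ Y) e ])
      ≡⟨ sym (∑-+ _ _) ⟩
    _ ∎
    where
    open ≡-Reasoning
    b = between (X ∖ᵇ Y) (X ∩ᵇ Y)
    pointwise : ∀ a b c d → [ a xor b ] + ([ ((a ∧ not c) ∧ (b ∧ d)) ∨ ((a ∧ c) ∧ (b ∧ not d)) ] + [ ((a ∧ not c) ∧ (b ∧ d)) ∨ ((a ∧ c) ∧ (b ∧ not d)) ]) ≡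
      [ (a ∧ not c) xor (b ∧ not d) ] + [ (a ∧ c) xor (b ∧ d) ]
    pointwise = Bool-identity _ _

  indicator-tabulate : ∀ (X : Fin n → Bool) → indicator (tabulate X) ≗ X
  indicator-tabulate X v with X v in eq
  ... | true  = dec-true (v ∈? tabulate X) (lookup⇒[]= v _ (trans (lookup∘tabulate X v) eq))
  ... | false = dec-false (v ∈? tabulate X) λ v∈ → case-⊥ (trans (sym ([]=⇒lookup v∈)) (trans (lookup∘tabulate X v) eq))
    where
    case-⊥ : true ≢ false
    case-⊥ ()

  module _ (s : Fin n) where

    otherEnd-crosses : ∀ {Z e} → Z s ≡ false → Incident G s e → Z (otherEnd G s e) ≡ crosses Z e
    otherEnd-crosses {Z} {e} Zs inc with tail e Fin.≟ s
    ... | yes refl = cong (_xor Z (head e)) (sym Zs)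
    otherEnd-crosses Zs (inj₁ t≡s) | no t≢s = contradiction t≡s t≢s
    otherEnd-crosses {Z} {e} Zs (inj₂ refl) | no t≢s = sym (trans (cong (Z (tail e) xor_) Zs) (Bool.xor-identityʳ _))

    sum-incident : ∀ h → Σℕ.sum (h ∘ lookup (incidentEdges G s)) ≡ Σℕ.sum (λ e → if does (incident? G s e) then h e else 0)
    sum-incident = sum-filter-allFin (incident? G s)

    incident-lookup : ∀ i → Incident G s (lookup (incidentEdges G s) i)
    incident-lookup i = proj₂ (∈-filter⁻ (incident? G s) {xs = allFin (length G)} (∈-lookup i))

    -- As `s` is outside `Z`, a deleted edge crosses `Z` exactly when its other end is inside, and
    -- the new edge crosses when these ends are separated. The losses are added on the left to avoid
    -- truncated subtraction.
    cut-lift : ∀ {e f} → e ≢ f → Incident G s e → Incident G s f → ∀ Z → Z s ≡ false →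
               Menger.cut (lift G s e f) Z + ([ Z (otherEnd G s e) ] + [ Z (otherEnd G s f) ]) ≡
               cut Z + [ Z (otherEnd G s e) xor Z (otherEnd G s f) ]
    cut-lift {e} {f} e≢f inc-e inc-f Z Zs = begin
      (x + Menger.cut (map (ends G) (filter keep? (allFin _))) Z) + ([ Z (otherEnd G s e) ] + [ Z (otherEnd G s f) ])
        ≡⟨ cong₂ (λ p q → (x + p) + q)
             (trans (sum-lookup-map (ends G) (filter keep? (allFin _)) (λ (u , v) → [ Z u xor Z v ])) (sum-filter-allFin keep? (λ g → [ crosses Z g ])))
             (cong₂ (λ p q → [ p ] + [ q ]) (otherEnd-crosses {Z} Zs inc-e) (otherEnd-crosses {Z} Zs inc-f)) ⟩
      (x + kept) + ([ crosses Z e ] + [ crosses Z f ])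
        -- The terms of `e` and `f` become sums over all edges, so that they can be merged with
        -- `kept` termwise.
        ≡⟨ cong₂ (λ p q → (x + kept) + (p + q)) (sym (sum-single (λ g → [ crosses Z g ]) e)) (sym (sum-single (λ g → [ crosses Z g ]) f)) ⟩
      (x + kept) + (only e + only f)                  ≡⟨ ℕ.+-assoc x kept _ ⟩
      x + (kept + (only e + only f))                  ≡⟨ cong (λ z → x + (kept + z)) (∑-+ _ _) ⟩
      x + (kept + _)                                  ≡⟨ cong (x +_) (∑-+ _ _) ⟩
      x + _                                           ≡⟨ cong (x +_) (Σℕ.sum-cong-≗ pointwise) ⟩
      x + cut Z                                       ≡⟨ ℕ.+-comm x (cut Z) ⟩
      cut Z + x ∎
      where
      open ≡-Reasoning
      keep? = λ g → ¬? (g Fin.≟ e) ×-dec ¬? (g Fin.≟ f)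
      x = [ Z (otherEnd G s e) xor Z (otherEnd G s f) ]
      kept = Σℕ.sum (λ g → if does (keep? g) then [ crosses Z g ] else 0)
      only = λ e′ → Σℕ.sum (λ g → if does (g Fin.≟ e′) then [ crosses Z g ] else 0)
      pointwise : ∀ g → (if does (keep? g) then [ crosses Z g ] else 0) +
        ((if does (g Fin.≟ e) then [ crosses Z g ] else 0) + (if does (g Fin.≟ f) then [ crosses Z g ] else 0)) ≡ [ crosses Z g ]
      pointwise g with g Fin.≟ e | g Fin.≟ f
      ... | yes refl | yes refl = contradiction refl e≢f
      ... | yes _    | no _     = ℕ.+-identityʳ _
      ... | no _     | yes _    = refl
      ... | no _     | no _     = ℕ.+-identityʳ _

-- Dangerous sets

module Lifting {n : ℕ} (G : Multigraph n) (loopless : Loopless G) (k : ℕ) (A : Subset n)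
  (linked : ∀ x y → x ∈ A → y ∈ A → x ≢ y → EdgeDisjointPaths G x y (2 * k))
  (independent : ∀ e → ¬ (proj₁ (ends G e) ∉ A × proj₂ (ends G e) ∉ A))
  (s : Fin n) (s∉A : s ∉ A) where

  open Menger G
  open Cuts G

  K : ℕ
  K = 2 * k

  edge : Fin (degree G s) → Edge G
  edge = lookup (incidentEdges G s)

  other : Fin (degree G s) → Fin n
  other i = otherEnd G s (edge i)

  edge-≢ : ∀ {i j} → i ≢ j → edge i ≢ edge j
  edge-≢ = unique-lookup (filter⁺ (incident? G s) (allFin⁺ (length G)))

  otherEnd∈A : ∀ e → Incident G s e → otherEnd G s e ∈ A
  otherEnd∈A e inc with tail e Fin.≟ s | inc
  ... | yes t≡s | _ = decidable-stable (_ ∈? A) λ h∉ → independent e (subst (_∉ A) (sym t≡s) s∉A , h∉)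
  ... | no t≢s | inj₁ t≡s = contradiction t≡s t≢s
  ... | no _ | inj₂ h≡s = decidable-stable (_ ∈? A) λ t∉ → independent e (t∉ , subst (_∉ A) (sym h≡s) s∉A)

  other∈A : ∀ i → other i ∈ A
  other∈A i = otherEnd∈A (edge i) (incident-lookup s i)

  Splits : (Fin n → Bool) → Set
  Splits X = (∃[ a ] a ∈ A × X a ≡ true) × (∃[ b ] b ∈ A × X b ≡ false)

  Dangerous : (Fin n → Bool) → Set
  Dangerous X = X s ≡ false × Splits X × cut X ≤ suc K

  dangerous? : ∀ X → Dec (Dangerous X)
  dangerous? X = (X s Bool.≟ false)
    ×-dec (any? (λ a → a ∈? A ×-dec X a Bool.≟ true) ×-dec any? (λ b → b ∈? A ×-dec X b Bool.≟ false))
    ×-dec (cut X ℕ.≤? suc K)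

  dangerous-resp : ∀ {X Y} → X ≗ Y → Dangerous X → Dangerous Y
  dangerous-resp X≗Y (Xs , ((a , a∈ , Xa) , (b , b∈ , Xb)) , small) =
    trans (sym (X≗Y s)) Xs
    , ((a , a∈ , trans (sym (X≗Y a)) Xa) , (b , b∈ , trans (sym (X≗Y b)) Xb))
    , subst (_≤ suc K) (cut-cong X≗Y) small

  true≢false : true ≢ false
  true≢false ()

  splits-≢ : ∀ {X : Fin n → Bool} {a b} → X a ≡ true → X b ≡ false → X a ≢ X b
  splits-≢ Xa Xb eq = true≢false (trans (sym Xa) (trans eq Xb))

  splits⇒cut≥ : ∀ X → Splits X → K ≤ cut X
  splits⇒cut≥ X ((a , a∈ , Xa) , (b , b∈ , Xb)) =
    disjointPaths-≤-cut X (splits-≢ {X} Xa Xb) (linked a b a∈ b∈ λ { refl → splits-≢ {X} Xa Xb refl })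

  trace : (Fin n → Bool) → Subset (degree G s)
  trace X = tabulate (X ∘ other)

  ∈trace⁺ : ∀ {X i} → X (other i) ≡ true → i ∈ trace X
  ∈trace⁺ {X} {i} eq = lookup⇒[]= i _ (trans (lookup∘tabulate (X ∘ other) i) eq)

  ∈trace⁻ : ∀ {X i} → i ∈ trace X → X (other i) ≡ true
  ∈trace⁻ {X} {i} i∈ = trans (sym (lookup∘tabulate (X ∘ other) i)) ([]=⇒lookup i∈)

  ∉trace⁻ : ∀ {X i} → i ∉ trace X → X (other i) ≡ false
  ∉trace⁻ {X} {i} i∉ = Bool.¬-not (i∉ ∘ ∈trace⁺ {X})

  ∣trace∣ : ∀ X → ∣ trace X ∣ ≡ Σℕ.sum (λ e → if does (incident? G s e) then [ X (otherEnd G s e) ] else 0)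
  ∣trace∣ X = trans (∣tabulate∣ (X ∘ other)) (sum-incident s (λ e → [ X (otherEnd G s e) ]))

  -- Quantifying over subsets instead of Boolean functions makes existence decidable by a finite
  -- search.
  DangerousTrace : Subset (degree G s) → Set
  DangerousTrace P = ∃[ Z ] Dangerous (indicator Z) × trace (indicator Z) ≡ P

  dangerousTrace? : ∀ P → Dec (DangerousTrace P)
  dangerousTrace? P = anySubset? λ Z → dangerous? (indicator Z) ×-dec trace (indicator Z) ≟ˢ P

  dangerous⇒trace : ∀ {X} → Dangerous X → DangerousTrace (trace X)
  dangerous⇒trace {X} dX = tabulate X , dangerous-resp (sym ∘ indicator-tabulate X) dX
    , tabulate-cong (indicator-tabulate X ∘ other)

  -- Moving `s` into `X` gives up the edges from `s` into `X` and gains the other edges at `s`. The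
  -- enlarged set still splits `A`, since `s` is not in `A`, so its cut is at least `K`.
  half-degree : ∀ {P} → DangerousTrace P → 2 * ∣ P ∣ ≤ suc (degree G s)
  half-degree (Z , (Xs , ((a , a∈ , Xa) , (b , b∈ , Xb)) , small) , refl) =
    ℕ.+-cancelˡ-≤ K _ _ (begin
      K + 2 * ∣ trace X ∣          ≤⟨ ℕ.+-monoˡ-≤ _ (splits⇒cut≥ X⁺ ((a , a∈ , a∈X⁺) , (b , b∈ , b∉X⁺))) ⟩
      cut X⁺ + 2 * ∣ trace X ∣     ≡⟨ identity ⟩
      cut X + degree G s           ≤⟨ ℕ.+-monoˡ-≤ _ small ⟩
      suc K + degree G s           ≡⟨ sym (ℕ.+-suc K _) ⟩
      K + suc (degree G s)         ∎)
    where
    open ℕ.≤-Reasoning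
    X = indicator Z
    X⁺ : Fin n → Bool
    X⁺ v = does (v Fin.≟ s) ∨ X v
    a∈X⁺ : X⁺ a ≡ true
    a∈X⁺ = trans (cong (does (a Fin.≟ s) ∨_) Xa) (Bool.∨-zeroʳ _)
    b∉X⁺ : X⁺ b ≡ false
    b∉X⁺ = trans (cong (_∨ X b) (dec-false (b Fin.≟ s) λ { refl → s∉A b∈ })) Xb
    inc : Edge G → ℕ → ℕ
    inc e m = if does (incident? G s e) then m else 0
    -- An edge from `s` into `X` contributes 2 on each side and any other edge at `s` contributes 1;
    -- a loop at `s` would violate this.
    pointwise : ∀ e → [ crosses X⁺ e ] + (inc e [ X (otherEnd G s e) ] + inc e [ X (otherEnd G s e) ]) ≡ [ crosses X e ] + inc e 1
    pointwise e with tail e Fin.≟ s | head e Fin.≟ s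
    ... | yes refl | yes h≡s = contradiction (sym h≡s) (loopless e)
    ... | yes refl | no _ rewrite Xs with X (head e)
    ...   | true  = refl
    ...   | false = refl
    pointwise e | no _ | yes refl rewrite Xs with X (tail e)
    ...   | true  = refl
    ...   | false = refl
    pointwise e | no _ | no _ = refl
    identity : cut X⁺ + 2 * ∣ trace X ∣ ≡ cut X + degree G s
    identity = ≡.begin
      cut X⁺ + 2 * ∣ trace X ∣     ≡.≡⟨ cong (λ z → cut X⁺ + (∣ trace X ∣ + z)) (ℕ.+-identityʳ _) ⟩
      cut X⁺ + (∣ trace X ∣ + ∣ trace X ∣) ≡.≡⟨ cong (λ z → cut X⁺ + (z + z)) (∣trace∣ X) ⟩
      _                            ≡.≡⟨ cong (cut X⁺ +_) (∑-+ _ _) ⟩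
      _                            ≡.≡⟨ ∑-+ _ _ ⟩
      _                            ≡.≡⟨ Σℕ.sum-cong-≗ pointwise ⟩
      _                            ≡.≡⟨ sym (∑-+ _ _) ⟩
      cut X + Σℕ.sum (λ e → inc e 1) ≡.≡⟨ cong (cut X +_) (trans (sym (sum-incident s (λ _ → 1))) (sum-const-1 _)) ⟩
      cut X + degree G s           ≡.∎
      where module ≡ = ≡-Reasoning

  -- Since `s` lies outside `X` and `Y`, each edge from `s` into the intersection runs from there to
  -- the outside of the union.
  ∣trace-∩∣≤edgesBetween : ∀ X Y → X s ≡ false → Y s ≡ false → ∣ trace (X ∩ᵇ Y) ∣ ≤ edgesBetween (X ∩ᵇ Y) (not ∘ (X ∪ᵇ Y))
  ∣trace-∩∣≤edgesBetween X Y Xs Ys = subst (_≤ edgesBetween (X ∩ᵇ Y) (not ∘ (X ∪ᵇ Y))) (sym (∣trace∣ (X ∩ᵇ Y))) (sum-mono pointwise)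
    where
    pointwise : ∀ e → (if does (incident? G s e) then [ (X ∩ᵇ Y) (otherEnd G s e) ] else 0) ≤ [ between (X ∩ᵇ Y) (not ∘ (X ∪ᵇ Y)) e ]
    pointwise e with tail e Fin.≟ s | head e Fin.≟ s
    ... | yes refl | _ rewrite Xs | Ys = ℕ.≤-refl
    ... | no _ | yes refl rewrite Xs | Ys with X (tail e) ∧ Y (tail e)
    ...   | true  = ℕ.≤-refl
    ...   | false = z≤n
    pointwise e | no _ | no _ = z≤n

  -- The indices `i`, `j`, `l` supply neighbours of `s`, hence vertices of `A`, in the intersection
  -- and both differences. All three sets therefore split `A` and have cuts of at least `K`.
  dangerous-cross : ∀ {X Y} → Dangerous X → Dangerous Y →
    ∀ i j l → X (other i) ∧ Y (other i) ≡ true → X (other j) ∧ not (Y (other j)) ≡ true → Y (other l) ∧ not (X (other l)) ≡ true →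
    ¬ Dangerous (X ∪ᵇ Y) →
    ∣ trace (X ∩ᵇ Y) ∣ ≤ 1 × (∀ a → a ∈ A → X a ∨ Y a ≡ true)
  dangerous-cross {X} {Y} (Xs , _ , X-small) (Ys , _ , Y-small) i j l i∈∩ j∈∖ l∈∖ safe-∪ = ∣∩∣≤1 , covers
    where
    open ℕ.≤-Reasoning
    a = cut X
    b = cut Y
    p = cut (X ∖ᵇ Y)
    q = cut (Y ∖ᵇ X)
    E = edgesBetween (X ∩ᵇ Y) (not ∘ (X ∪ᵇ Y))
    ∖-false : ∀ x y → x ∧ y ≡ true → x ∧ not y ≡ false
    ∖-false true true _ = refl
    ∖-false′ : ∀ x y → x ∧ y ≡ true → y ∧ not x ≡ false
    ∖-false′ true true _ = refl
    ∧-false : ∀ x y → x ∧ not y ≡ true → x ∧ y ≡ false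
    ∧-false true false _ = refl
    ∨-true : ∀ x y → x ∧ y ≡ true → x ∨ y ≡ true
    ∨-true true _ _ = refl
    K≤p : K ≤ p
    K≤p = splits⇒cut≥ (X ∖ᵇ Y) ((other j , other∈A j , j∈∖) , (other i , other∈A i , ∖-false (X (other i)) (Y (other i)) i∈∩))
    K≤q : K ≤ q
    K≤q = splits⇒cut≥ (Y ∖ᵇ X) ((other l , other∈A l , l∈∖) , (other i , other∈A i , ∖-false′ (X (other i)) (Y (other i)) i∈∩))
    a+b≤ : a + b ≤ (K + K) + 2
    a+b≤ = ℕ.≤-trans (ℕ.+-mono-≤ X-small Y-small) (ℕ.≤-reflexive (lemma K))
      where
      lemma : ∀ K → suc K + suc K ≡ (K + K) + 2
      lemma = ℕ-solve-∀
    i∈trace : i ∈ trace (X ∩ᵇ Y)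
    i∈trace = ∈trace⁺ {X ∩ᵇ Y} i∈∩
    1≤E : 1 ≤ E
    1≤E = ℕ.≤-trans (ℕ.≤-trans (s≤s z≤n) (x∈p⇒∣p-x∣<∣p∣ i∈trace)) (∣trace-∩∣≤edgesBetween X Y Xs Ys)
    -- Edges counted by `E` enter `cut-∖-∖` twice, and `K≤p` and `K≤q` leave room for at most 2.
    E≤1 : E ≤ 1
    E≤1 = ℕ.≮⇒≥ λ 2≤E → ℕ.<⇒≱ (ℕ.+-mono-≤ 2≤E (ℕ.≤-trans (s≤s z≤n) 2≤E)) (ℕ.+-cancelˡ-≤ (K + K) (E + E) 2 (begin
      (K + K) + (E + E) ≤⟨ ℕ.+-monoˡ-≤ (E + E) (ℕ.+-mono-≤ K≤p K≤q) ⟩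
      (p + q) + (E + E) ≡⟨ sym (cut-∖-∖ X Y) ⟩
      a + b             ≤⟨ a+b≤ ⟩
      (K + K) + 2       ∎))
    ∣∩∣≤1 : ∣ trace (X ∩ᵇ Y) ∣ ≤ 1
    ∣∩∣≤1 = ℕ.≤-trans (∣trace-∩∣≤edgesBetween X Y Xs Ys) E≤1
    -- The edge provided by `1≤E` uses up the whole slack of 2.
    p≡K : p ≡ K
    p≡K = squeeze-≥ K≤p K≤q (ℕ.+-cancelʳ-≤ 2 (p + q) (K + K) (begin
      (p + q) + 2       ≤⟨ ℕ.+-monoʳ-≤ (p + q) (ℕ.+-mono-≤ 1≤E 1≤E) ⟩
      (p + q) + (E + E) ≡⟨ sym (cut-∖-∖ X Y) ⟩
      a + b             ≤⟨ a+b≤ ⟩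
      (K + K) + 2       ∎))
    -- If X ∪ Y missed a vertex of A, all cuts below would be tight, and then
    -- d(X) = 2k + 1 would have the parity of d(X ∖ Y) + d(X ∩ Y) = 4k.
    covers : ∀ v → v ∈ A → X v ∨ Y v ≡ true
    covers v v∈A with X v ∨ Y v in v∉∪
    ... | true  = refl
    ... | false = contradiction parity (ℕ.even≢odd (k + k) (k + E′))
      where
      c = cut (X ∩ᵇ Y)
      u = cut (X ∪ᵇ Y)
      D = edgesBetween (X ∖ᵇ Y) (Y ∖ᵇ X)
      E′ = edgesBetween (X ∖ᵇ Y) (X ∩ᵇ Y)
      -- The union avoids `s` and splits `A` between `other i` and `v`, so only the size of its cut
      -- can keep it from being dangerous.
      K+2≤u : K + 2 ≤ u
      K+2≤u = ℕ.≮⇒≥ λ u<K+2 → safe-∪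
        ( cong₂ _∨_ Xs Ys
        , ((other i , other∈A i , ∨-true (X (other i)) (Y (other i)) i∈∩) , (v , v∈A , v∉∪))
        , ℕ.≤-pred (subst (u <_) (ℕ.+-comm K 2) u<K+2))
      c+u≤a+b : c + u ≤ a + b
      c+u≤a+b = subst (c + u ≤_) (sym (cut-∩-∪ X Y)) (ℕ.m≤m+n (c + u) (D + D))
      K≤c : K ≤ c
      K≤c = splits⇒cut≥ (X ∩ᵇ Y) ((other i , other∈A i , i∈∩) , (other j , other∈A j , ∧-false (X (other j)) (Y (other j)) j∈∖))
      c≡K : c ≡ K
      c≡K = squeeze-≥ K≤c K+2≤u (ℕ.≤-trans c+u≤a+b (ℕ.≤-trans a+b≤ (ℕ.≤-reflexive (ℕ.+-assoc K K 2))))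
      a≡1+K : a ≡ suc K
      a≡1+K = squeeze-≤ X-small Y-small (ℕ.≤-trans (ℕ.≤-reflexive (lemma K)) (ℕ.≤-trans (ℕ.+-mono-≤ K≤c K+2≤u) c+u≤a+b))
        where
        lemma : ∀ K → suc K + suc K ≡ K + (K + 2)
        lemma = ℕ-solve-∀
      parity : 2 * (k + k) ≡ suc (2 * (k + E′))
      parity = begin-equality
        2 * (k + k)               ≡⟨ lemma₁ k ⟩
        K + K                     ≡⟨ sym (cong₂ _+_ p≡K c≡K) ⟩
        p + c                     ≡⟨ sym (cut-∖-∩ X Y) ⟩
        a + (E′ + E′)             ≡⟨ cong (_+ (E′ + E′)) a≡1+K ⟩
        suc K + (E′ + E′)         ≡⟨ lemma₂ k E′ ⟩
        suc (2 * (k + E′))        ∎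
        where
        lemma₁ : ∀ k → 2 * (k + k) ≡ 2 * k + 2 * k
        lemma₁ = ℕ-solve-∀
        lemma₂ : ∀ k e → suc (2 * k) + (e + e) ≡ suc (2 * (k + e))
        lemma₂ = ℕ-solve-∀

  -- The case split is on the union of the chosen dangerous sets. If it is not dangerous it contains
  -- `A`, hence every neighbour of `s`, so the two traces cover all edges at `s`.
  trace-cross : ∀ {P Q} → DangerousTrace P → DangerousTrace Q → Nonempty (P ∩ Q) → Nonempty (P ─ Q) → Nonempty (Q ─ P) →
                DangerousTrace (P ∪ Q) ⊎ (∣ P ∩ Q ∣ ≡ 1 × P ∪ Q ≡ ⊤)
  trace-cross {P} {Q} (Z , dX , refl) (W , dY , refl) (i , i∈) (j , j∈) (l , l∈)
    with dangerous? (indicator Z ∪ᵇ indicator W)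
  ... | yes d∪ = inj₁ (subst DangerousTrace (sym (zipWith-tabulate _∨_ (indicator Z ∘ other) (indicator W ∘ other))) (dangerous⇒trace d∪))
  ... | no ¬d∪ = inj₂ (ℕ.≤-antisym (subst (λ z → ∣ z ∣ ≤ 1) (sym ∩≡) (proj₁ crossing)) (ℕ.≤-trans (s≤s z≤n) (x∈p⇒∣p-x∣<∣p∣ i∈)) , ∪≡⊤)
    where
    X = indicator Z
    Y = indicator W
    ∩≡ : trace X ∩ trace Y ≡ trace (X ∩ᵇ Y)
    ∩≡ = zipWith-tabulate _∧_ (X ∘ other) (Y ∘ other)
    ∈─ : ∀ {X Y i} → i ∈ trace X ─ trace Y → X (other i) ∧ not (Y (other i)) ≡ true
    ∈─ {X} {Y} i∈ = cong₂ (λ x y → x ∧ not y) (∈trace⁻ {X} (p─q⊆p _ _ i∈)) (∉trace⁻ {Y} (x∈p─q⇒x∉q _ _ i∈))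
    crossing = dangerous-cross dX dY i j l (∈trace⁻ {X ∩ᵇ Y} (subst (i ∈_) ∩≡ i∈)) (∈─ {X} {Y} j∈) (∈─ {Y} {X} l∈) ¬d∪
    ∪≡⊤ : trace X ∪ trace Y ≡ ⊤
    ∪≡⊤ = ⊆-antisym {i = trace X ∪ trace Y} {j = ⊤} (λ _ → ∈⊤) λ {m} _ → subst (m ∈_) (sym (zipWith-tabulate _∨_ (X ∘ other) (Y ∘ other)))
      (∈trace⁺ {X ∪ᵇ Y} (proj₂ crossing (other m) (other∈A m)))


  -- Admissible pairs and dangerous sets

  τ-≤ : ∀ x y {m} → (x ∈ A → y ∈ A → K ≤ m) → τ A k x y ≤ m
  τ-≤ x y K≤m with x ∈? A | y ∈? A
  ... | yes x∈ | yes y∈ = K≤m x∈ y∈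
  ... | yes _  | no _   = z≤n
  ... | no _   | _      = z≤n

  τ≡K : ∀ {x y} → x ∈ A → y ∈ A → τ A k x y ≡ K
  τ≡K {x} {y} x∈ y∈ = cong (λ b → if b then K else 0) (cong₂ _∧_ (dec-true (x ∈? A) x∈) (dec-true (y ∈? A) y∈))

  separated⇒splits : ∀ W {x y} → x ∈ A → y ∈ A → W x ≢ W y → Splits W
  separated⇒splits W {x} {y} x∈ y∈ Wx≢Wy with W x in eqx | W y in eqy
  ... | true  | true  = contradiction refl Wx≢Wy
  ... | true  | false = (x , x∈ , eqx) , (y , y∈ , eqy)
  ... | false | true  = (y , y∈ , eqy) , (x , x∈ , eqx)
  ... | false | false = contradiction refl Wx≢Wy

  module _ {i j : Fin (degree G s)} (i≢j : i ≢ j) where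

    H : Multigraph n
    H = lift G s (edge i) (edge j)

    module H = Menger H

    cut-H : ∀ Z → Z s ≡ false → H.cut Z + ([ Z (other i) ] + [ Z (other j) ]) ≡ cut Z + [ Z (other i) xor Z (other j) ]
    cut-H = cut-lift s (edge-≢ i≢j) (incident-lookup s i) (incident-lookup s j)

    cut-H-both : ∀ Z → Z s ≡ false → Z (other i) ≡ true → Z (other j) ≡ true → H.cut Z + 2 ≡ cut Z
    cut-H-both Z Zs Zi Zj = trans
      (subst₂ (λ p q → H.cut Z + ([ p ] + [ q ]) ≡ cut Z + [ p xor q ]) Zi Zj (cut-H Z Zs)) (ℕ.+-identityʳ _)

    -- Lifting two edges into a dangerous set lowers its cut to at most `2k - 1`, too little for
    -- `2k` disjoint paths between the vertices of `A` that it separates.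
    admissible⇒apart : Admissible G s (τ A k) (edge i) (edge j) → ¬ Together DangerousTrace i j
    admissible⇒apart adm (_ , (Z , (Zs , ((a , a∈ , Za) , (b , b∈ , Zb)) , small) , refl) , i∈ , j∈) =
      let m , (paths , _) , τ≤m = adm a b (λ { refl → s∉A a∈ }) (λ { refl → s∉A b∈ }) a≢b in
      ℕ.<⇒≱ (ℕ.≤-reflexive (ℕ.+-comm 2 K)) (begin
        K + 2        ≤⟨ ℕ.+-monoˡ-≤ 2 (subst (_≤ m) (τ≡K a∈ b∈) τ≤m) ⟩
        m + 2        ≤⟨ ℕ.+-monoˡ-≤ 2 (H.disjointPaths-≤-cut X Xa≢Xb paths) ⟩
        H.cut X + 2  ≡⟨ cut-H-both X Zs (∈trace⁻ {X} i∈) (∈trace⁻ {X} j∈) ⟩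
        cut X        ≤⟨ small ⟩
        suc K        ∎)
      where
      open ℕ.≤-Reasoning
      X = indicator Z
      Xa≢Xb : X a ≢ X b
      Xa≢Xb = splits-≢ {X} {a} {b} Za Zb
      a≢b : a ≢ b
      a≢b refl = Xa≢Xb refl

    -- The cut changes only if both other ends lie in `W`; then `W` is not dangerous, so its cut was
    -- at least `K + 2` and drops by 2. If just one end is inside, the new edge replaces the lost
    -- one.
    apart⇒cut-H≥ : ¬ Together DangerousTrace i j → ∀ W → W s ≡ false → Splits W → K ≤ H.cut W
    apart⇒cut-H≥ apart W Ws splits = go (W (other i)) (W (other j)) refl refl
      where
      unchanged : ∀ c {m} → H.cut W + c ≡ m + c → K ≤ m → K ≤ H.cut W
      unchanged c eq = subst (K ≤_) (sym (ℕ.+-cancelʳ-≡ c _ _ eq))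
      go : ∀ p q → W (other i) ≡ p → W (other j) ≡ q → K ≤ H.cut W
      go p q Wi Wj with subst₂ (λ p q → H.cut W + ([ p ] + [ q ]) ≡ cut W + [ p xor q ]) Wi Wj (cut-H W Ws)
      go true  true  Wi Wj | _  = ℕ.+-cancelʳ-≤ 2 K (H.cut W) (subst (K + 2 ≤_) (sym (cut-H-both W Ws Wi Wj)) (ℕ.≮⇒≥ λ small →
        apart (trace W , dangerous⇒trace (Ws , splits , ℕ.≤-pred (subst (cut W <_) (ℕ.+-comm K 2) small)) , ∈trace⁺ {W} Wi , ∈trace⁺ {W} Wj)))
      go true  false _ _ | eq = unchanged 1 eq (splits⇒cut≥ W splits)
      go false true  _ _ | eq = unchanged 1 eq (splits⇒cut≥ W splits)
      go false false _ _ | eq = unchanged 0 eq (splits⇒cut≥ W splits)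

    -- Menger's theorem in the lifted graph gives a cut equal to the local edge-connectivity, so
    -- bounding cuts suffices.
    apart⇒admissible : ¬ Together DangerousTrace i j → Admissible G s (τ A k) (edge i) (edge j)
    apart⇒admissible apart x y _ _ x≢y with Z , sep , paths ← H.menger x y x≢y =
      H.cut X , (paths , λ c → H.disjointPaths-≤-cut X sep) , τ-≤ x y K≤
      where
      X = H.indicator Z
      K≤ : x ∈ A → y ∈ A → K ≤ H.cut X
      K≤ x∈ y∈ with X s in Xs
      ... | false = apart⇒cut-H≥ apart X Xs (separated⇒splits X x∈ y∈ sep)
      -- Dangerous sets avoid `s`, so a cut side containing `s` is exchanged for its complement,
      -- which has the same cut.
      ... | true  = subst (K ≤_) (Cuts.cut-complement H X)
        (apart⇒cut-H≥ apart (not ∘ X) (cong not Xs) (separated⇒splits (not ∘ X) x∈ y∈ (sep ∘ Bool.not-injective)))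

  liftingGraph-iff : ∀ i j → LiftingGraph G s (τ A k) i j ⇔ (i ≢ j × ¬ Together DangerousTrace i j)
  liftingGraph-iff i j = mk⇔ (λ (i≢j , adm) → i≢j , admissible⇒apart i≢j adm) (λ (i≢j , apart) → i≢j , apart⇒admissible i≢j apart)

theorem3p3 : (n : ℕ) (G : Multigraph n) → Loopless G →
    (k : ℕ) → 0 < k →
    (A : Subset n) → A ⊂ ⊤ →
    (∀ x y → x ∈ A → y ∈ A → x ≢ y → EdgeDisjointPaths G x y (2 * k)) →
    (∀ e → ¬ (proj₁ (ends G e) ∉ A × proj₂ (ends G e) ∉ A)) →
    (s : Fin n) → s ∉ A → 3 < degree G s →
    let L = LiftingGraph G s (τ A k) in
    (CompleteMultipartite L ⊎ IsolatedVertexPlusBalancedCompleteBipartite L)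
    × (IsolatedVertexPlusBalancedCompleteBipartite L → ¬ (2 ∣ degree G s))
theorem3p3 n G loopless k _ A _ linked independent s s∉A 3<deg =
  multipartite-or-balanced 3<deg DangerousTrace dangerousTrace? half-degree trace-cross liftingGraph-iff
  , balanced⇒odd
  where
  open Lifting G loopless k A linked independent s s∉A
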